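{- The following decision problem (the Common Term problem for dwindling convergent string-rewriting systems) is undecidable. Given a finite non-empty alphabet $\Sigma$, strings $\alpha,\beta\in\Sigma^*$, and a finite string-rewriting system $S$ over $\Sigma$ that is dwindling and convergent, decide whether there exists a string $W\in\Sigma^*$ such that $\alpha W \approx_S \beta W$, i.e. $\alpha W \stackrel{*}{\longleftrightarrow}_S \beta W$.
   Context: A string-rewriting system (SRS) $S$ over $\Sigma$ is a set of rules $l\to r$ with $l,r\in\Sigma^*$; the one-step reduction is $\to_S=\{(xly,xry): (l\to r)\in S,\ x,y\in\Sigma^*\}$, $\stackrel{*}{\longleftrightarrow}_S$ (also written $\approx_S$) is the reflexive, symmetric, transitive closure of $\to_S$. $S$ is terminating if there is no infinite chain $u_0\to_S u_1\to_S\cdots$; confluent if whenever $s_1 \leftarrow_S^* t\to_S^* s_2$ there is $t'$ with $s_1\to_S^* t' \leftarrow_S^* s_2$; convergent if both terminating and confluent. $S$ is dwindling if for every rule $l\to r$ in $S$, $r$ is a proper prefix of $l$. -}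

module Defs where

open import Data.Nat using (ℕ; zero; suc; _+_; _<_)
open import Data.Fin using (Fin; toℕ)
open import Data.Vec using (Vec; []; _∷_; lookup)
open import Data.List using (List; []; _∷_; _++_; map)
open import Data.List.Membership.Propositional using (_∈_)
open import Data.Product using (Σ; ∃; _×_; _,_)
open import Data.Empty using (⊥)
open import Relation.Nullary using (¬_)
open import Relation.Binary.PropositionalEquality using (_≡_)
open import Relation.Binary.Construct.Closure.ReflexiveTransitive using (Star)
open import Relation.Binary.Construct.Closure.Equivalence using (EqClosure)

-- String-rewriting systems over the alphabet Σ = Fin (suc k)
-- (every finite non-empty alphabet, up to renaming of letters)

Str : ℕ → Set
Str k = List (Fin (suc k))

Rule : ℕ → Set
Rule k = Str k × Str k

SRS : ℕ → Set
SRS k = List (Rule k)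

Step : ∀ {k} → SRS k → Str k → Str k → Set
Step {k} S u v = Σ (Str k) λ x → Σ (Str k) λ y → Σ (Str k) λ l → Σ (Str k) λ r →
  ((l , r) ∈ S) × (u ≡ x ++ l ++ y) × (v ≡ x ++ r ++ y)

Steps : ∀ {k} → SRS k → Str k → Str k → Set
Steps S = Star (Step S)

Conv : ∀ {k} → SRS k → Str k → Str k → Set
Conv S = EqClosure (Step S)

Terminating : ∀ {k} → SRS k → Set
Terminating {k} S = ¬ (Σ (ℕ → Str k) λ u → ∀ i → Step S (u i) (u (suc i)))

Confluent : ∀ {k} → SRS k → Set
Confluent {k} S = ∀ t s₁ s₂ → Steps S t s₁ → Steps S t s₂ →
  Σ (Str k) λ t' → Steps S s₁ t' × Steps S s₂ t'

Convergent : ∀ {k} → SRS k → Set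
Convergent S = Terminating S × Confluent S

ProperPrefix : ∀ {k} → Str k → Str k → Set
ProperPrefix {k} r l = Σ (Fin (suc k)) λ a → Σ (Str k) λ z → l ≡ r ++ (a ∷ z)

Dwindling : ∀ {k} → SRS k → Set
Dwindling {k} S = ∀ (l r : Str k) → (l , r) ∈ S → ProperPrefix r l

CommonTerm : ∀ {k} → SRS k → Str k → Str k → Set
CommonTerm {k} S α β = Σ (Str k) λ W → Conv S (α ++ W) (β ++ W)

data PR : ℕ → Set where
  zer  : ∀ {n} → PR n
  succ : PR 1
  proj : ∀ {n} → Fin n → PR n
  comp : ∀ {m n} → PR m → Vec (PR n) m → PR n
  prec : ∀ {n} → PR n → PR (suc (suc n)) → PR (suc n)
  mu   : ∀ {n} → PR (suc n) → PR n

mutual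
  data Eval : ∀ {n} → PR n → Vec ℕ n → ℕ → Set where
    e-zer  : ∀ {n} {xs : Vec ℕ n} → Eval zer xs 0
    e-succ : ∀ {x} → Eval succ (x ∷ []) (suc x)
    e-proj : ∀ {n} {i : Fin n} {xs} → Eval (proj i) xs (lookup xs i)
    e-comp : ∀ {m n} {f : PR m} {gs : Vec (PR n) m} {xs ys y} →
             EvalVec gs xs ys → Eval f ys y → Eval (comp f gs) xs y
    e-prec-z : ∀ {n} {g : PR n} {h xs y} →
             Eval g xs y → Eval (prec g h) (0 ∷ xs) y
    e-prec-s : ∀ {n} {g : PR n} {h xs x y z} →
             Eval (prec g h) (x ∷ xs) y → Eval h (x ∷ y ∷ xs) z →
             Eval (prec g h) (suc x ∷ xs) z
    e-mu   : ∀ {n} {f : PR (suc n)} {xs y} →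
             Eval f (y ∷ xs) 0 →
             (∀ i → i < y → Σ ℕ λ m → Eval f (i ∷ xs) (suc m)) →
             Eval (mu f) xs y

  data EvalVec : ∀ {m n} → Vec (PR n) m → Vec ℕ n → Vec ℕ m → Set where
    ev-[] : ∀ {n} {xs : Vec ℕ n} → EvalVec [] xs []
    ev-∷  : ∀ {m n} {g : PR n} {gs : Vec (PR n) m} {xs y ys} →
            Eval g xs y → EvalVec gs xs ys → EvalVec (g ∷ gs) xs (y ∷ ys)

tri : ℕ → ℕ
tri zero = zero
tri (suc n) = suc n + tri n

-- Cantor pairing
pair : ℕ → ℕ → ℕ
pair x y = tri (x + y) + y

encList : List ℕ → ℕ
encList [] = 0
encList (x ∷ xs) = suc (pair x (encList xs))

encStr : ∀ {k} → Str k → ℕ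
encStr w = encList (map toℕ w)

encRule : ∀ {k} → Rule k → ℕ
encRule (l , r) = encList (encStr l ∷ encStr r ∷ [])

encSRS : ∀ {k} → SRS k → ℕ
encSRS S = encList (map encRule S)

encInstance : (k : ℕ) → Str k → Str k → SRS k → ℕ
encInstance k α β S = encList (k ∷ encStr α ∷ encStr β ∷ encSRS S ∷ [])

DecidesCommonTerm : PR 1 → Set
DecidesCommonTerm f = ∀ (k : ℕ) (α β : Str k) (S : SRS k) →
  Dwindling S → Convergent S →
  (CommonTerm S α β → Eval f (encInstance k α β S ∷ []) 1) ×
  (¬ CommonTerm S α β → Eval f (encInstance k α β S ∷ []) 0)

{-# OPTIONS --safe #-}
module Submission where

-- A decider f, applied to the instance made of its input, is turned into a register program
-- whose outcome is encoded in a system S; the two inputs of the program, kept in unary in α,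
-- are the alphabet size and the code of S itself. So α W ≈ β W is solvable for this instance
-- exactly if f answers 0 on it. No universal machine is needed, and in both cases the program halts.
--
-- All rules have the form d x ! → r with a trigger letter !. Hence reducing a string is running
-- a stack machine on it, the token x ! leading from a stack with top d to one where x has been
-- pushed, d has been popped or nothing has happened, according to d and x. Two stacks that
-- process the same W can check a computation: configurations are words, swept from end to end,
-- one stack holding the unread part of the old word and the other the new word. Each token is
-- checked by one stack against the letter that it reads and by the other against the letter
-- written before, and a trigger that finds no redex stays forever, making the results differ.

open import Defs
open import Data.Bool using (Bool; true; false; if_then_else_)
open import Data.Empty using (⊥; ⊥-elim)
open import Data.Fin using (Fin; zero; suc; toℕ; join; splitAt; combine; remQuot)
import Data.Fin.Properties as Fin
open import Data.List using (List; []; _∷_; _++_; _ʳ++_; reverse; map; foldl; length; concatMap; allFin; replicate)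
open import Data.List.Membership.Propositional using (_∈_)
open import Data.List.Membership.Propositional.Properties using (∈-concatMap⁺; ∈-concatMap⁻; ∈-allFin)
open import Data.List.Properties
  using (ʳ++-defn; ʳ++-ʳ++; ++-ʳ++; ++-identityʳ; length-++; foldl-++; ≡-dec; map-injective; ++-cancelˡ)
import Data.List.Relation.Unary.Any as Any
open Any using (here)
open import Data.List.Relation.Unary.Linked as Linked using (Linked; [-])
open import Data.Maybe as Maybe using (Maybe; just; nothing; maybe′)
open import Data.Nat using (ℕ; zero; suc; _+_; _*_; _<_; _≤_; _⊔_; s≤s; z≤n; _≟_)
open import Data.Nat.Induction using (<-wellFounded)
import Data.Nat.Properties as ℕ
open import Data.Product using (Σ; ∃; _×_; _,_; proj₁; proj₂)
open import Data.Sum using (_⊎_; inj₁; inj₂)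
open import Data.Unit using (⊤; tt)
open import Data.Vec as Vec using (Vec; []; _∷_; lookup)
import Data.Vec.Properties as Vec
open import Data.Vec.Relation.Unary.All as All using (All; []; _∷_)
open import Function using (_∘_)
open import Induction.WellFounded using (Acc; acc)
open import Relation.Binary.Construct.Closure.Equivalence using (symmetric)
open import Relation.Binary.Construct.Closure.ReflexiveTransitive using (Star; ε; _◅_; _◅◅_)
open import Relation.Binary.Construct.Closure.Symmetric using (fwd; bwd)
open import Relation.Binary.Definitions using (DecidableEquality)
open import Relation.Binary.PropositionalEquality
  using (_≡_; _≢_; refl; sym; trans; cong; cong₂; subst; module ≡-Reasoning)
open import Relation.Nullary using (¬_; yes; no; contradiction; Dec)
open import Relation.Nullary.Decidable using (map′; _×-dec_)

-- Token machines as string-rewriting systems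

data Move : Set where
  push pop skip : Move

eff : ∀ {A : Set} → Move → A → A → List A → List A
eff push d x s = x ∷ d ∷ s
eff pop  d x s = s
eff skip d x s = d ∷ s

-- The letter zero is the trigger, suc x is the letter x of the token machine.
module TokenSystem {k : ℕ} (act : Fin k → Fin k → Maybe Move) where

  Stack : Set
  Stack = List (Fin k)

  plain : Stack → Str k
  plain = map suc

  -- The three moves yield exactly the three proper prefixes of `redex d x`, so any table `act`
  -- gives a dwindling system.
  contractum : Move → Fin k → Fin k → Str k
  contractum m d x = eff m (suc d) (suc x) [] ʳ++ []

  redex : Fin k → Fin k → Str k
  redex d x = suc d ∷ suc x ∷ zero ∷ []

  rule : Fin k → Fin k → SRS k
  rule d x = maybe′ (λ m → (redex d x , contractum m d x) ∷ []) [] (act d x)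

  rules : SRS k
  rules = concatMap (λ d → concatMap (rule d) (allFin k)) (allFin k)

  ∈-rule : ∀ {d x m} → act d x ≡ just m → (redex d x , contractum m d x) ∈ rule d x
  ∈-rule eq rewrite eq = here refl

  ∈-rules : ∀ {d x m} → act d x ≡ just m → (redex d x , contractum m d x) ∈ rules
  ∈-rules {d} {x} eq = ∈-concatMap⁺ _ (Any.map (λ { refl →
    ∈-concatMap⁺ _ (Any.map (λ { refl → ∈-rule eq }) (∈-allFin x)) }) (∈-allFin d))

  rules-inv : ∀ {l r} → (l , r) ∈ rules →
    ∃ λ d → ∃ λ x → ∃ λ m → act d x ≡ just m × l ≡ redex d x × r ≡ contractum m d x
  rules-inv i with Any.satisfied (∈-concatMap⁻ _ {xs = allFin k} i)
  ... | d , j with Any.satisfied (∈-concatMap⁻ (rule d) {xs = allFin k} j)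
  ...   | x , h with act d x in eq
  rules-inv i | d , j | x , here refl | just m = d , x , m , eq , refl , refl

  dwindling : Dwindling rules
  dwindling l r i with rules-inv i
  ... | d , x , push , _ , refl , refl = zero , [] , refl
  ... | d , x , pop  , _ , refl , refl = suc d , suc x ∷ zero ∷ [] , refl
  ... | d , x , skip , _ , refl , refl = suc x , zero ∷ [] , refl

  -- Stacks are strings written with the last letter first.
  react : Maybe Move → Fin k → Fin k → Str k → Str k
  react (just m) d x s = eff m (suc d) (suc x) s
  react nothing  d x s = zero ∷ suc x ∷ suc d ∷ s

  fire : Str k → Str k
  fire (suc x ∷ suc d ∷ s) = react (act d x) d x s
  fire s                   = zero ∷ s

  feed : Str k → Fin (suc k) → Str k
  feed s zero    = fire s
  feed s (suc x) = suc x ∷ s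

  -- `run [] u` is the reversed normal form of `u`: a redex is complete only when its trigger is
  -- read, and contracta contain no trigger, so one pass from the left suffices.
  run : Str k → Str k → Str k
  run = foldl feed

  run-contractum : ∀ {d x m} s → act d x ≡ just m → run s (redex d x) ≡ run s (contractum m d x)
  run-contractum {m = push} s eq rewrite eq = refl
  run-contractum {m = pop}  s eq rewrite eq = refl
  run-contractum {m = skip} s eq rewrite eq = refl

  run-step : ∀ {u v} s → Step rules u v → run s u ≡ run s v
  run-step s (x , y , l , r , i , refl , refl) with rules-inv i
  ... | d , a , m , eq , refl , refl = begin
    run s (x ++ redex d a ++ y)                   ≡⟨ foldl-++ feed s x _ ⟩
    run (run s x) (redex d a ++ y)                ≡⟨ foldl-++ feed (run s x) (redex d a) y ⟩
    run (run (run s x) (redex d a)) y             ≡⟨ cong (λ t → run t y) (run-contractum (run s x) eq) ⟩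
    run (run (run s x) (contractum m d a)) y      ≡⟨ foldl-++ feed (run s x) (contractum m d a) y ⟨
    run (run s x) (contractum m d a ++ y)         ≡⟨ foldl-++ feed s x _ ⟨
    run s (x ++ contractum m d a ++ y)            ∎
    where open ≡-Reasoning

  run-steps : ∀ {u v} s → Steps rules u v → run s u ≡ run s v
  run-steps s ε        = refl
  run-steps s (p ◅ ps) = trans (run-step s p) (run-steps s ps)

  run-conv : ∀ {u v} s → Conv rules u v → run s u ≡ run s v
  run-conv s ε             = refl
  run-conv s (fwd p ◅ ps)  = trans (run-step s p) (run-conv s ps)
  run-conv s (bwd p ◅ ps)  = trans (sym (run-step s p)) (run-conv s ps)

  step-at : ∀ {d x m} s w → act d x ≡ just m →
    Step rules (s ʳ++ redex d x ++ w) (eff m (suc d) (suc x) s ʳ++ w)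
  step-at {d} {x} {m} s w eq =
    reverse s , w , _ , _ , ∈-rules eq , ʳ++-defn s , trans (lemma m) (ʳ++-defn s)
    where
    lemma : ∀ m → eff m (suc d) (suc x) s ʳ++ w ≡ s ʳ++ contractum m d x ++ w
    lemma push = refl
    lemma pop  = refl
    lemma skip = refl

  steps-fire : ∀ s w → Steps rules (s ʳ++ zero ∷ w) (fire s ʳ++ w)
  steps-fire []                    w = ε
  steps-fire (zero ∷ s)            w = ε
  steps-fire (suc x ∷ [])          w = ε
  steps-fire (suc x ∷ zero ∷ s)    w = ε
  steps-fire (suc x ∷ suc d ∷ s)   w with act d x in eq
  ... | nothing = ε
  ... | just m  = step-at s w eq ◅ ε

  steps-run : ∀ s w → Steps rules (s ʳ++ w) (run s w ʳ++ [])
  steps-run s []          = ε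
  steps-run s (zero ∷ w)  = steps-fire s w ◅◅ steps-run (fire s) w
  steps-run s (suc x ∷ w) = steps-run (suc x ∷ s) w

  steps⇒conv : ∀ {u v} → Steps rules u v → Conv rules u v
  steps⇒conv ε        = ε
  steps⇒conv (p ◅ ps) = fwd p ◅ steps⇒conv ps

  -- Reduction preserves the value under `run []`, so both reducts share it, and each reduces to the
  -- string that it spells.
  confluent : Confluent rules
  confluent t u v p q = run [] u ʳ++ [] , steps-run [] u ,
    subst (λ s → Steps rules v (s ʳ++ [])) (trans (sym (run-steps [] q)) (run-steps [] p)) (steps-run [] v)

  step-shrinks : ∀ {u v} → Step rules u v → length v < length u
  step-shrinks (x , y , l , r , i , refl , refl) with dwindling l r i
  ... | a , z , refl rewrite length-++ x {(r ++ a ∷ z) ++ y} | length-++ x {r ++ y}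
                           | length-++ (r ++ a ∷ z) {y} | length-++ r {a ∷ z} | length-++ r {y} =
    ℕ.+-monoʳ-< (length x) (ℕ.+-monoˡ-< (length y) (ℕ.m<m+n (length r) (s≤s z≤n)))

  terminating : Terminating rules
  terminating (u , chain) = go 0 (<-wellFounded _)
    where
    go : ∀ i → Acc _<_ (length (u i)) → ⊥
    go i (acc h) = go (suc i) (h (step-shrinks (chain i)))

  convergent : Convergent rules
  convergent = terminating , confluent

  step : Stack → Fin k → Maybe Stack
  step []      x = nothing
  step (d ∷ s) x = Maybe.map (λ m → eff m d x s) (act d x)

  -- This is what remains of the Common Term problem: W becomes a sequence of tokens on which both
  -- stacks stay alive until they coincide.
  data Reach : Stack → Stack → Set where
    equal : ∀ {s} → Reach s s
    token : ∀ {s s' t t'} x → step s x ≡ just s' → step t x ≡ just t' → Reach s' t' → Reach s t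

  reach-sym : ∀ {s t} → Reach s t → Reach t s
  reach-sym equal           = equal
  reach-sym (token x p q r) = token x q p (reach-sym r)

  fire-step : ∀ s {s'} x → step s x ≡ just s' → fire (suc x ∷ plain s) ≡ plain s'
  fire-step (d ∷ s) x eq with act d x
  fire-step (d ∷ s) x refl | just push = refl
  fire-step (d ∷ s) x refl | just pop  = refl
  fire-step (d ∷ s) x refl | just skip = refl

  fire-stuck : ∀ s x → step s x ≡ nothing → fire (suc x ∷ plain s) ≡ zero ∷ suc x ∷ plain s
  fire-stuck []      x eq = refl
  fire-stuck (d ∷ s) x eq with act d x
  ... | nothing = refl

  reach⇒run : ∀ {s t} → Reach s t → ∃ λ W → run (plain s) W ≡ run (plain t) W
  reach⇒run equal = [] , refl
  reach⇒run {s} {t} (token x p q r) with reach⇒run r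
  ... | W , eq = suc x ∷ zero ∷ W ,
    trans (cong (λ v → run v W) (fire-step s x p)) (trans eq (sym (cong (λ v → run v W) (fire-step t x q))))

  -- Normal forms and stuck triggers

  Irr : Str k → Set
  Irr []                           = ⊤
  Irr (zero ∷ suc x ∷ suc d ∷ s)   = act d x ≡ nothing × Irr (suc x ∷ suc d ∷ s)
  Irr (_ ∷ s)                      = Irr s

  irr-tail : ∀ a s → Irr (a ∷ s) → Irr s
  irr-tail zero    []                  p = p
  irr-tail zero    (zero ∷ s)          p = p
  irr-tail zero    (suc x ∷ [])        p = p
  irr-tail zero    (suc x ∷ zero ∷ s)  p = p
  irr-tail zero    (suc x ∷ suc d ∷ s) p = proj₂ p
  irr-tail (suc a) s                   p = p

  irr-drop : ∀ u s → Irr (u ʳ++ s) → Irr s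
  irr-drop []      s p = p
  irr-drop (a ∷ u) s p = irr-tail a s (irr-drop u (a ∷ s) p)

  irr-take : ∀ u s → Irr (u ++ s) → Irr u
  irr-take []                        s p       = tt
  irr-take (suc a ∷ u)               s p       = irr-take u s p
  irr-take (zero ∷ [])               s p       = tt
  irr-take (zero ∷ zero ∷ u)         s p       = irr-take (zero ∷ u) s p
  irr-take (zero ∷ suc x ∷ [])       s p       = tt
  irr-take (zero ∷ suc x ∷ zero ∷ u) s p       = irr-take (zero ∷ u) s p
  irr-take (zero ∷ suc x ∷ suc d ∷ u) s (p , q) = p , irr-take u s q

  ʳ++-++ : ∀ {A : Set} (u : List A) {v w} → u ʳ++ (v ++ w) ≡ (u ʳ++ v) ++ w
  ʳ++-++ []      = refl
  ʳ++-++ (a ∷ u) {v} {w} = ʳ++-++ u {a ∷ v} {w}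

  irr-suffix : ∀ a u → Irr ((a ∷ u) ʳ++ []) → Irr (u ʳ++ [])
  irr-suffix a u p = irr-take (u ʳ++ []) (a ∷ []) (subst Irr (ʳ++-++ u {[]}) p)

  irr-fire : ∀ s → Irr s → Irr (fire s)
  irr-fire []                  p = tt
  irr-fire (zero ∷ s)          p = p
  irr-fire (suc x ∷ [])        p = p
  irr-fire (suc x ∷ zero ∷ s)  p = p
  irr-fire (suc x ∷ suc d ∷ s) p with act d x in eq
  ... | just push = p
  ... | just pop  = p
  ... | just skip = p
  ... | nothing   = eq , p

  irr-run : ∀ s w → Irr s → Irr (run s w)
  irr-run s []          p = p
  irr-run s (zero ∷ w)  p = irr-run (fire s) w (irr-fire s p)
  irr-run s (suc x ∷ w) p = irr-run (suc x ∷ s) w p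

  -- Such a segment shields the stack below it, because firing inspects at most two letters and
  -- never anything below a trigger.
  data Solid : Str k → Set where
    trig : ∀ {s} → Solid (zero ∷ s)
    long : ∀ {a b s} → Solid (a ∷ b ∷ s)

  solid-push : ∀ {a s} → Solid s → Solid (a ∷ s)
  solid-push trig = long
  solid-push long = long

  -- Every trigger of `w` finds the letters that it inspects inside `w` and `t`, where
  -- irreducibility excludes a rule, so `w` piles up unchanged.
  run-solid : ∀ w t s → Solid t → Irr (w ʳ++ t) → run (t ++ s) w ≡ (w ʳ++ t) ++ s
  run-solid []          t s q p = refl
  run-solid (suc x ∷ w) t s q p = run-solid w (suc x ∷ t) s (solid-push q) p
  run-solid (zero ∷ w)  t s q p =
    trans (cong (λ v → run v w) (stuck t q (irr-drop w (zero ∷ t) p))) (run-solid w (zero ∷ t) s trig p)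
    where
    stuck : ∀ t → Solid t → Irr (zero ∷ t) → fire (t ++ s) ≡ zero ∷ t ++ s
    stuck (zero ∷ t)          q    i = refl
    stuck (suc x ∷ zero ∷ t)  long i = refl
    stuck (suc x ∷ suc d ∷ t) long (e , i) rewrite e = refl

  triggers : Str k → ℕ
  triggers []          = 0
  triggers (zero ∷ s)  = suc (triggers s)
  triggers (suc x ∷ s) = triggers s

  triggers-fire : ∀ s → triggers (fire s) ≤ suc (triggers s)
  triggers-fire []                  = ℕ.≤-refl
  triggers-fire (zero ∷ s)          = ℕ.≤-refl
  triggers-fire (suc x ∷ [])        = ℕ.≤-refl
  triggers-fire (suc x ∷ zero ∷ s)  = ℕ.≤-refl
  triggers-fire (suc x ∷ suc d ∷ s) with act d x
  ... | just push = ℕ.n≤1+n _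
  ... | just pop  = ℕ.n≤1+n _
  ... | just skip = ℕ.n≤1+n _
  ... | nothing   = ℕ.≤-refl

  triggers-run : ∀ s w → triggers (run s w) ≤ triggers w + triggers s
  triggers-run s []          = ℕ.≤-refl
  triggers-run s (suc x ∷ w) = triggers-run (suc x ∷ s) w
  triggers-run s (zero ∷ w)  = ℕ.≤-trans (triggers-run (fire s) w)
    (ℕ.≤-trans (ℕ.+-monoʳ-≤ (triggers w) (triggers-fire s)) (ℕ.≤-reflexive (ℕ.+-suc (triggers w) _)))

  triggers-++ : ∀ u v → triggers (u ++ v) ≡ triggers u + triggers v
  triggers-++ []          v = refl
  triggers-++ (zero ∷ u)  v = cong suc (triggers-++ u v)
  triggers-++ (suc x ∷ u) v = triggers-++ u v

  triggers-ʳ++ : ∀ u v → triggers (u ʳ++ v) ≡ triggers u + triggers v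
  triggers-ʳ++ []          v = refl
  triggers-ʳ++ (zero ∷ u)  v = trans (triggers-ʳ++ u (zero ∷ v)) (ℕ.+-suc (triggers u) _)
  triggers-ʳ++ (suc x ∷ u) v = triggers-ʳ++ u (suc x ∷ v)

  triggers-plain : ∀ s → triggers (plain s) ≡ 0
  triggers-plain []      = refl
  triggers-plain (x ∷ s) = triggers-plain s

  plain-injective : ∀ {s t} → plain s ≡ plain t → s ≡ t
  plain-injective = map-injective Fin.suc-injective

  -- A trigger that meets such a pair has no effect or is stuck.
  Adjacent : Fin k → Fin k → Set
  Adjacent x d = act d x ≡ just push ⊎ act d x ≡ nothing

  Settled : Stack → Set
  Settled = Linked Adjacent

  -- A letter gets on top of another only by a push, and the table entry for this push is the
  -- adjacency required.
  settled-step : ∀ {s s'} x → Settled s → step s x ≡ just s' → Settled s'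
  settled-step {d ∷ s} x p eq with act d x in a
  settled-step {d ∷ s} x p refl | just push = inj₁ a Linked.∷ p
  settled-step {d ∷ s} x p refl | just pop  = Linked.tail p
  settled-step {d ∷ s} x p refl | just skip = p

  -- This is for a trigger of W without a letter of its own before it, which takes the top of the
  -- stack for its token.
  fire-settled : ∀ {s} → Settled s → fire (plain s) ≡ plain s ⊎ fire (plain s) ≡ zero ∷ plain s
  fire-settled Linked.[]             = inj₂ refl
  fire-settled [-]                   = inj₂ refl
  fire-settled (inj₁ e Linked.∷ p) rewrite e = inj₁ refl
  fire-settled (inj₂ e Linked.∷ p) rewrite e = inj₂ refl

  -- Without triggers at the start, a stack ends with at most those of w; a stuck one adds to them.
  stuck≢live : ∀ w u s t → triggers u ≡ 1 → Solid u → Irr (w ʳ++ u) →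
    run (u ++ plain s) w ≡ run (plain t) w → ⊥
  stuck≢live w u s t one solid irr eq = ℕ.<-irrefl refl (begin-strict
    triggers w                               <⟨ ℕ.n<1+n _ ⟩
    suc (triggers w)                         ≡⟨ ℕ.+-comm (triggers w) 1 ⟨
    triggers w + 1                           ≡⟨ cong (triggers w +_) one ⟨
    triggers w + triggers u                  ≡⟨ triggers-ʳ++ w u ⟨
    triggers (w ʳ++ u)                       ≡⟨ ℕ.+-identityʳ _ ⟨
    triggers (w ʳ++ u) + 0                   ≡⟨ cong (triggers (w ʳ++ u) +_) (triggers-plain s) ⟨
    triggers (w ʳ++ u) + triggers (plain s)  ≡⟨ triggers-++ (w ʳ++ u) (plain s) ⟨
    triggers ((w ʳ++ u) ++ plain s)          ≡⟨ cong triggers (run-solid w u (plain s) solid irr) ⟨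
    triggers (run (u ++ plain s) w)          ≡⟨ cong triggers eq ⟩
    triggers (run (plain t) w)               ≤⟨ triggers-run (plain t) w ⟩
    triggers w + triggers (plain t)          ≡⟨ cong (triggers w +_) (triggers-plain t) ⟩
    triggers w + 0                           ≡⟨ ℕ.+-identityʳ _ ⟩
    triggers w                               ∎)
    where open ℕ.≤-Reasoning

  solid-cancel : ∀ w u {s t} → Solid u → Irr (w ʳ++ u) →
    run (u ++ plain s) w ≡ run (u ++ plain t) w → s ≡ t
  solid-cancel w u {s} {t} q i eq = plain-injective (++-cancelˡ (w ʳ++ u) _ _
    (trans (sym (run-solid w u (plain s) q i)) (trans eq (run-solid w u (plain t) q i))))

  -- Induction along `w`. Tokens alive on both stacks are followed. At the first other letter,
  -- shielding takes over: if both stacks are shielded they were equal before, and if only one is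
  -- stuck it keeps a surplus trigger.
  run⇒reach : ∀ w s t → Irr (w ʳ++ []) → Settled s → Settled t →
    run (plain s) w ≡ run (plain t) w → Reach s t
  run⇒reach w s t irr ps pt eq with ≡-dec Fin._≟_ s t
  run⇒reach w s t irr ps pt eq | yes refl = equal
  run⇒reach []  s t irr ps pt eq | no s≢t = contradiction (plain-injective eq) s≢t
  run⇒reach (zero ∷ w) s t irr ps pt eq | no s≢t with fire-settled ps | fire-settled pt
  ... | inj₁ e | inj₁ f rewrite e | f = run⇒reach w s t (irr-suffix zero w irr) ps pt eq
  ... | inj₂ e | inj₂ f rewrite e | f = contradiction (solid-cancel w (zero ∷ []) trig irr eq) s≢t
  ... | inj₂ e | inj₁ f rewrite e | f = ⊥-elim (stuck≢live w (zero ∷ []) s t refl trig irr eq)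
  ... | inj₁ e | inj₂ f rewrite e | f = ⊥-elim (stuck≢live w (zero ∷ []) t s refl trig irr (sym eq))
  run⇒reach (suc x ∷ []) s t irr ps pt eq | no s≢t =
    contradiction (plain-injective (++-cancelˡ (suc x ∷ []) _ _ eq)) s≢t
  -- Two letters without a trigger in between form a solid segment, so the rest of the word never
  -- gets through to `s` or `t`.
  run⇒reach (suc x ∷ suc y ∷ w) s t irr ps pt eq | no s≢t =
    contradiction (solid-cancel w (suc y ∷ suc x ∷ []) long irr eq) s≢t
  run⇒reach (suc x ∷ zero ∷ w) s t irr ps pt eq | no s≢t with step s x in e | step t x in f
  ... | just s' | just t' rewrite fire-step s x e | fire-step t x f =
    token x e f (run⇒reach w s' t' (irr-suffix zero w (irr-suffix (suc x) (zero ∷ w) irr))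
      (settled-step x ps e) (settled-step x pt f) eq)
  ... | nothing | nothing rewrite fire-stuck s x e | fire-stuck t x f =
    contradiction (solid-cancel w (zero ∷ suc x ∷ []) trig irr eq) s≢t
  ... | nothing | just t' rewrite fire-stuck s x e | fire-step t x f =
    ⊥-elim (stuck≢live w (zero ∷ suc x ∷ []) s t' refl trig irr eq)
  ... | just s' | nothing rewrite fire-step s x e | fire-stuck t x f =
    ⊥-elim (stuck≢live w (zero ∷ suc x ∷ []) t s' refl trig irr (sym eq))

  run-plain : ∀ s a → run s (plain a) ≡ plain a ʳ++ s
  run-plain s []      = refl
  run-plain s (x ∷ a) = run-plain (suc x ∷ s) a

  plain-ʳ++ : ∀ a s → plain a ʳ++ plain s ≡ plain (a ʳ++ s)
  plain-ʳ++ []      s = refl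
  plain-ʳ++ (x ∷ a) s = plain-ʳ++ a (x ∷ s)

  run-word : ∀ a W → run [] (plain a ++ W) ≡ run (plain (a ʳ++ [])) W
  run-word a W = trans (foldl-++ feed [] (plain a) W)
    (cong (λ s → run s W) (trans (run-plain [] a) (plain-ʳ++ a [])))

  conv-run : ∀ u → Conv rules u (run [] u ʳ++ [])
  conv-run u = steps⇒conv (steps-run [] u)

  reach⇒commonTerm : ∀ a b → Reach (a ʳ++ []) (b ʳ++ []) → CommonTerm rules (plain a) (plain b)
  reach⇒commonTerm a b r with reach⇒run r
  ... | W , eq = W , (conv-run _ ◅◅ subst (λ s → Conv rules (s ʳ++ []) (plain b ++ W))
    (trans (run-word b W) (trans (sym eq) (sym (run-word a W)))) (symmetric _ (conv-run (plain b ++ W))))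

  -- The common term may be replaced by its normal form.
  commonTerm⇒reach : ∀ a b → Settled (a ʳ++ []) → Settled (b ʳ++ []) →
    CommonTerm rules (plain a) (plain b) → Reach (a ʳ++ []) (b ʳ++ [])
  commonTerm⇒reach a b pa pb (W , c) = run⇒reach V _ _
      (subst Irr (sym (trans (ʳ++-ʳ++ (run [] W) {[]} {[]}) (++-identityʳ _))) (irr-run [] W tt)) pa pb
      (trans (sym (via a)) (trans (run-conv [] c) (via b)))
    where
    V = run [] W ʳ++ []
    via : ∀ a → run [] (plain a ++ W) ≡ run (plain (a ʳ++ [])) V
    via a = trans (run-word a W) (run-conv _ (conv-run W))

-- Finite types

record Finite (X : Set) : Set where
  field
    size    : ℕ
    enc     : X → Fin size
    dec     : Fin size → X
    dec-enc : ∀ x → dec (enc x) ≡ x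

  enc-injective : ∀ {x y} → enc x ≡ enc y → x ≡ y
  enc-injective {x} {y} eq = trans (sym (dec-enc x)) (trans (cong dec eq) (dec-enc y))

  _≡?_ : DecidableEquality X
  x ≡? y = map′ enc-injective (cong enc) (enc x Fin.≟ enc y)

fin-finite : ∀ n → Finite (Fin n)
fin-finite n = record { size = n ; enc = λ i → i ; dec = λ i → i ; dec-enc = λ _ → refl }

⊤-finite : Finite ⊤
⊤-finite = record { size = 1 ; enc = λ _ → zero ; dec = λ _ → tt ; dec-enc = λ _ → refl }

bool-finite : Finite Bool
bool-finite = record
  { size = 2
  ; enc = λ { false → zero ; true → suc zero }
  ; dec = λ { zero → false ; (suc zero) → true }
  ; dec-enc = λ { false → refl ; true → refl } }

_⊎-finite_ : ∀ {X Y} → Finite X → Finite Y → Finite (X ⊎ Y)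
_⊎-finite_ {X} {Y} F G = record { size = F.size + G.size ; enc = e ; dec = d ∘ splitAt F.size ; dec-enc = de }
  where
  module F = Finite F
  module G = Finite G
  e : X ⊎ Y → Fin (F.size + G.size)
  e (inj₁ x) = join F.size G.size (inj₁ (F.enc x))
  e (inj₂ y) = join F.size G.size (inj₂ (G.enc y))
  d : Fin F.size ⊎ Fin G.size → X ⊎ Y
  d (inj₁ i) = inj₁ (F.dec i)
  d (inj₂ j) = inj₂ (G.dec j)
  de : ∀ z → d (splitAt F.size (e z)) ≡ z
  de (inj₁ x) = trans (cong d (Fin.splitAt-join F.size G.size (inj₁ (F.enc x)))) (cong inj₁ (F.dec-enc x))
  de (inj₂ y) = trans (cong d (Fin.splitAt-join F.size G.size (inj₂ (G.enc y)))) (cong inj₂ (G.dec-enc y))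

_×-finite_ : ∀ {X Y} → Finite X → Finite Y → Finite (X × Y)
_×-finite_ {X} {Y} F G = record
  { size = F.size * G.size
  ; enc = λ (x , y) → combine (F.enc x) (G.enc y)
  ; dec = d ∘ remQuot G.size
  ; dec-enc = λ (x , y) → trans (cong d (Fin.remQuot-combine (F.enc x) (G.enc y)))
                                (cong₂ _,_ (F.dec-enc x) (G.dec-enc y)) }
  where
  module F = Finite F
  module G = Finite G
  d : Fin F.size × Fin G.size → X × Y
  d (i , j) = F.dec i , G.dec j

vec-finite : ∀ {X} → Finite X → ∀ n → Finite (Vec X n)
vec-finite F zero    = record { size = 1 ; enc = λ _ → zero ; dec = λ _ → [] ; dec-enc = λ { [] → refl } }
vec-finite F (suc n) = record
  { size = P.size
  ; enc = λ { (x ∷ xs) → P.enc (x , xs) }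
  ; dec = cons ∘ P.dec
  ; dec-enc = λ { (x ∷ xs) → cong cons (P.dec-enc (x , xs)) } }
  where
  module P = Finite (F ×-finite vec-finite F n)
  cons : _ → _
  cons (x , xs) = x ∷ xs

-- Sweeping automata as token machines

Label : Set
Label = Fin 3

next : Label → Label
next zero             = suc zero
next (suc zero)       = suc (suc zero)
next (suc (suc zero)) = zero

next≢ : ∀ l → l ≢ next l
next≢ zero             ()
next≢ (suc zero)       ()
next≢ (suc (suc zero)) ()

-- This fails modulo 2 and is the reason for three labels.
next²≢ : ∀ l → l ≢ next (next l)
next²≢ zero             ()
next²≢ (suc zero)       ()
next²≢ (suc (suc zero)) ()

-- A sweeping automaton reads its word from one end to the other with δ, writing a new
-- word; at the end of a sweep, turn changes the state and appends a letter, and the next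
-- sweep runs over the new word in the opposite direction.
record Sweeper : Set₁ where
  field
    Q A      : Set
    Q-finite : Finite Q
    A-finite : Finite A
    δ        : Q → A → Q × A
    turn     : Q → Maybe (Q × A)
    accept   : Q → Bool
    -- Acceptance lasts to the end of the sweep, so that all letters written from then on can be
    -- wiped.
    accept-δ : ∀ q a → accept q ≡ true → accept (proj₁ (δ q a)) ≡ true
    q₀       : Q
    a₀       : A
    input    : Bool → A

module SweepSystem (M : Sweeper) where
  open Sweeper M

  data Config : Set where
    ⟨_,_,_⟩ : Q → List A → List A → Config

  infix 4 _⟶_

  data _⟶_ : Config → Config → Set where
    read   : ∀ {q a u v} → accept q ≡ false →
             ⟨ q , a ∷ u , v ⟩ ⟶ ⟨ proj₁ (δ q a) , u , proj₂ (δ q a) ∷ v ⟩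
    switch : ∀ {q v q' b} → accept q ≡ false → turn q ≡ just (q' , b) →
             ⟨ q , [] , v ⟩ ⟶ ⟨ q' , b ∷ v , [] ⟩

  _⟶*_ : Config → Config → Set
  _⟶*_ = Star _⟶_

  -- A reading token carries a flag for the first letter of a sweep, the number of the sweep, the
  -- state before reading and the letter read. The second kind ends a sweep, the third clears the
  -- stack after acceptance.
  Token : Set
  Token = (Bool × Label × Q × A) ⊎ (Label × Q) ⊎ ⊤

  data X : Set where
    bot : X
    inp : Bool → X
    ini : X
    tok : Token → X

  pattern rd f l q a = tok (inj₁ (f , l , q , a))
  pattern end l q    = tok (inj₂ (inj₁ (l , q)))
  pattern wipe       = tok (inj₂ (inj₂ tt))

  token-finite : Finite Token
  token-finite =
    (bool-finite ×-finite (fin-finite 3 ×-finite (Q-finite ×-finite A-finite))) ⊎-finite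
    ((fin-finite 3 ×-finite Q-finite) ⊎-finite ⊤-finite)

  open Finite Q-finite using () renaming (_≡?_ to _≟Q_)
  open Finite A-finite using () renaming (_≡?_ to _≟A_)
  module T = Finite token-finite

  k : ℕ
  k = 4 + T.size

  enc : X → Fin k
  enc bot         = zero
  enc (inp false) = suc zero
  enc (inp true)  = suc (suc zero)
  enc ini         = suc (suc (suc zero))
  enc (tok t)     = suc (suc (suc (suc (T.enc t))))

  dec : Fin k → X
  dec zero                        = bot
  dec (suc zero)                  = inp false
  dec (suc (suc zero))            = inp true
  dec (suc (suc (suc zero)))      = ini
  dec (suc (suc (suc (suc i))))   = tok (T.dec i)

  dec-enc : ∀ x → dec (enc x) ≡ x
  dec-enc bot         = refl
  dec-enc (inp false) = refl
  dec-enc (inp true)  = refl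
  dec-enc ini         = refl
  dec-enc (tok t)     = cong tok (T.dec-enc t)

  -- What a letter on a stack stands for: body l q b is the letter b written in a sweep
  -- numbered l (mod 3), after which the state was q; last l q b is the one appended at its end.
  data View : Set where
    base      : View
    body last : Label → Q → A → View
    junk      : View

  afterTurn : Label → Maybe (Q × A) → View
  afterTurn l (just (q , b)) = last l q b
  afterTurn l nothing        = junk

  -- The input letters pass for the outcome of a sweep numbered 2 that ended in `q₀`, so the
  -- computation begins with sweep 0.
  view : X → View
  view bot          = base
  view (inp i)      = body (suc (suc zero)) q₀ (input i)
  view ini          = last (suc (suc zero)) q₀ a₀
  view (rd f l q a) = body l (proj₁ (δ q a)) (proj₂ (δ q a))
  view (end l q)    = afterTurn l (turn q)
  view wipe         = junk

  -- One of the two stacks holds what is left to read, the other what has been written in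
  -- the current sweep. Numbering the sweeps mod 3 prevents a stale letter, left on the
  -- stack being read, from passing for a freshly written one.
  data Ok : View → X → Move → Set where
    base-first : ∀ {l q a} → Ok base (rd true l q a) push
    base-end   : ∀ {l q} → Ok base (end l q) skip
    base-wipe  : Ok base wipe skip
    body-write : ∀ {l q b m q' a} → m ≡ l → q' ≡ q → Ok (body l q b) (rd false m q' a) push
    body-read  : ∀ {l q b m q' a} → m ≡ next l → a ≡ b → Ok (body l q b) (rd false m q' a) pop
    body-end   : ∀ {l q b m q' z} → m ≡ l → q' ≡ q → turn q ≡ just z → Ok (body l q b) (end m q') push
    body-wipe  : ∀ {l q b} → accept q ≡ true → Ok (body l q b) wipe pop
    -- Nothing has been written yet in the new sweep, so the appended letter has to check label,
    -- state and letter all at once.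
    last-first : ∀ {l q b m q' a} → m ≡ next l → q' ≡ q → a ≡ b → Ok (last l q b) (rd true m q' a) pop

  ok? : ∀ v x → Dec (∃ (Ok v x))
  ok? base         (rd true l q a)  = yes (push , base-first)
  ok? base         (rd false l q a) = no λ ()
  ok? base         (end l q)        = yes (skip , base-end)
  ok? base         wipe             = yes (skip , base-wipe)
  ok? base         bot              = no λ ()
  ok? base         (inp _)          = no λ ()
  ok? base         ini              = no λ ()
  ok? (body l q b) bot              = no λ ()
  ok? (body l q b) (inp _)          = no λ ()
  ok? (body l q b) ini              = no λ ()
  ok? (body l q b) (rd true _ _ _)  = no λ ()
  ok? (body l q b) (rd false m q' a) with m Fin.≟ l ×-dec q' ≟Q q | m Fin.≟ next l ×-dec a ≟A b
  ... | yes (e , f) | _           = yes (push , body-write e f)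
  ... | no _        | yes (e , f) = yes (pop , body-read e f)
  ... | no n        | no r        = no λ { (_ , body-write e f) → n (e , f) ; (_ , body-read e f) → r (e , f) }
  ok? (body l q b) (end m q') with m Fin.≟ l ×-dec q' ≟Q q | turn q in eq
  ... | yes (e , f) | just z  = yes (push , body-end e f eq)
  ... | yes _       | nothing = no λ { (_ , body-end _ _ e) → contradiction (trans (sym e) eq) λ () }
  ... | no n        | _       = no λ { (_ , body-end e f _) → n (e , f) }
  ok? (body l q b) wipe with accept q in eq
  ... | true  = yes (pop , body-wipe eq)
  ... | false = no λ { (_ , body-wipe e) → contradiction (trans (sym e) eq) λ () }
  ok? (last l q b) bot              = no λ ()
  ok? (last l q b) (inp _)          = no λ ()
  ok? (last l q b) ini              = no λ ()
  ok? (last l q b) (rd false _ _ _) = no λ ()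
  ok? (last l q b) (rd true m q' a) with m Fin.≟ next l ×-dec (q' ≟Q q ×-dec a ≟A b)
  ... | yes (e , f , g) = yes (pop , last-first e f g)
  ... | no n            = no λ { (_ , last-first e f g) → n (e , f , g) }
  ok? (last l q b) (end _ _)        = no λ ()
  ok? (last l q b) wipe             = no λ ()
  ok? junk x                        = no λ ()

  -- Writing on a letter requires its own label and reading it requires the next one, so the two
  -- cannot be confused.
  ok-unique : ∀ {v x m n} → Ok v x m → Ok v x n → m ≡ n
  ok-unique base-first         base-first         = refl
  ok-unique base-end           base-end           = refl
  ok-unique base-wipe          base-wipe          = refl
  ok-unique (body-write _ _)   (body-write _ _)   = refl
  ok-unique (body-write e _)   (body-read f _)    = contradiction (trans (sym e) f) (next≢ _)
  ok-unique (body-read f _)    (body-write e _)   = contradiction (trans (sym e) f) (next≢ _)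
  ok-unique (body-read _ _)    (body-read _ _)    = refl
  ok-unique (body-end _ _ _)   (body-end _ _ _)   = refl
  ok-unique (body-wipe _)      (body-wipe _)      = refl
  ok-unique (last-first _ _ _) (last-first _ _ _) = refl

  -- Codes are inspected through `dec` only, so one outside the image of `enc` behaves like the
  -- letter that it decodes to.
  act : Fin k → Fin k → Maybe Move
  act d x with ok? (view (dec d)) (dec x)
  ... | yes (m , _) = just m
  ... | no _        = nothing

  ok⇒act : ∀ {d x m} → Ok (view (dec d)) (dec x) m → act d x ≡ just m
  ok⇒act {d} {x} o with ok? (view (dec d)) (dec x)
  ... | yes (n , o') = cong just (ok-unique o' o)
  ... | no ¬o        = contradiction (_ , o) ¬o

  act⇒ok : ∀ {d x m} → act d x ≡ just m → Ok (view (dec d)) (dec x) m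
  act⇒ok {d} {x} eq with ok? (view (dec d)) (dec x)
  act⇒ok refl | yes (_ , o) = o

  open TokenSystem act public

  emit : ∀ {v v' m n} x d s e t → view (dec d) ≡ v → Ok v x m → view (dec e) ≡ v' → Ok v' x n →
    Reach (eff m d (enc x) s) (eff n e (enc x) t) → Reach (d ∷ s) (e ∷ t)
  emit x d s e t p o q o' = token (enc x) (ok⇒step d s p o) (ok⇒step e t q o')
    where
    ok⇒step : ∀ {v m} d s → view (dec d) ≡ v → Ok v x m → step (d ∷ s) (enc x) ≡ just (eff m d (enc x) s)
    ok⇒step {m = m} d s refl o
      rewrite ok⇒act {d} {enc x} (subst (λ y → Ok (view (dec d)) y m) (sym (dec-enc x)) o) = refl

  step⇒ok : ∀ {v s'} d s x → view (dec d) ≡ v → step (d ∷ s) x ≡ just s' →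
    ∃ λ m → Ok v (dec x) m × s' ≡ eff m d x s
  step⇒ok d s x refl eq with act d x in e
  step⇒ok d s x refl refl | just m = m , act⇒ok {d} {x} e , refl

  ⊥ˢ : Fin k
  ⊥ˢ = enc bot

  -- Configurations as pairs of stacks

  data Holds (l : Label) : List A → Stack → Set where
    []  : Holds l [] (⊥ˢ ∷ [])
    _∷_ : ∀ {q b w i s} → view (dec i) ≡ body l q b → Holds l w s → Holds l (b ∷ w) (i ∷ s)

  -- The state is kept in the letter made last: the appended one before a sweep, the top of the
  -- writing stack during it.
  data Rep : Config → Stack → Stack → Set where
    start : ∀ {l q b u i s} → view (dec i) ≡ last l q b → Holds l u s →
            Rep ⟨ q , b ∷ u , [] ⟩ (i ∷ s) (⊥ˢ ∷ [])
    mid   : ∀ {l q b u v i s t} → Holds l u s →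
            view (dec i) ≡ body (next l) q b → Holds (next l) v t →
            Rep ⟨ q , u , b ∷ v ⟩ s (i ∷ t)

  Rep± : Config → Stack → Stack → Set
  Rep± c s t = Rep c s t ⊎ Rep c t s

  -- The top letters differ in kind or in label, so the stacks cannot coincide while they represent
  -- a configuration.
  rep-irrefl : ∀ {c s} → ¬ Rep c s s
  rep-irrefl (start e _) with trans (sym e) refl
  ... | ()
  rep-irrefl (mid [] () _)
  rep-irrefl (mid (_∷_ {i = i} e h) f _) with trans (sym e) f
  ... | p = next≢ _ (label≡ p)
    where
    label≡ : ∀ {l m q q' b b'} → body l q b ≡ body m q' b' → l ≡ m
    label≡ refl = refl

  status : Config → Bool
  status ⟨ q , _ , _ ⟩ = accept q

  afterRead : ∀ {x f l q a} → x ≡ rd f l q a → view x ≡ body l (proj₁ (δ q a)) (proj₂ (δ q a))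
  afterRead refl = refl

  afterEnd : ∀ {x l q q' b} → x ≡ end l q → turn q ≡ just (q' , b) → view x ≡ last l q' b
  afterEnd refl e rewrite e = refl

  -- The two checks together determine the token. Other combinations clash in the labels, and wiping
  -- needs an accepting state.
  forced : ∀ {c s t s' t'} x → Rep c s t → status c ≡ false →
    step s x ≡ just s' → step t x ≡ just t' → ∃ λ c' → c ⟶ c' × Rep± c' s' t'
  forced x (start {l} {i = i} {s = s} e h) na p q with dec x in eq | step⇒ok i s x e p | step⇒ok ⊥ˢ [] x refl q
  ... | .(rd true (next l) _ _) | _ , last-first refl refl refl , refl | _ , base-first , refl =
    _ , read na , inj₁ (mid h (afterRead eq) [])
  forced x (mid {l} {i = i} {t = r} [] f t) na p q with dec x in eq | step⇒ok ⊥ˢ [] x refl p | step⇒ok i r x f q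
  ... | .(end (next l) _) | _ , base-end , refl | _ , body-end refl refl z , refl =
    _ , switch na z , inj₂ (start (afterEnd eq z) (f ∷ t))
  ... | _ | _ , base-wipe , refl | _ , body-wipe z , refl = contradiction (trans (sym z) na) λ ()
  forced x (mid {l} {i = i} {t = r} (_∷_ {i = j} {s = s} e h) f t) na p q with dec x in eq | step⇒ok j s x e p | step⇒ok i r x f q
  ... | _ | _ , body-write m _ , refl | _ , body-write n _ , refl = contradiction (trans (sym m) n) (next≢ l)
  -- Here the stacks have exchanged their roles in the middle of a sweep, which two labels would not
  -- exclude.
  ... | _ | _ , body-write m _ , refl | _ , body-read n _ , refl = contradiction (trans (sym m) n) (next²≢ l)
  ... | .(rd false (next l) _ _) | _ , body-read refl refl , refl | _ , body-write _ refl , refl =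
    _ , read na , inj₁ (mid h (afterRead eq) (f ∷ t))
  ... | _ | _ , body-read m _ , refl | _ , body-read n _ , refl = contradiction (trans (sym m) n) (next≢ (next l))
  ... | _ | _ , body-end m _ _ , refl | _ , body-end n _ _ , refl = contradiction (trans (sym m) n) (next≢ l)
  ... | _ | _ , body-wipe _ , refl | _ , body-wipe z , refl = contradiction (trans (sym z) na) λ ()

  ⟶-deterministic : ∀ {c d e} → c ⟶ d → c ⟶ e → d ≡ e
  ⟶-deterministic (read _)     (read _)     = refl
  ⟶-deterministic (switch _ e) (switch _ f) with trans (sym e) f
  ... | refl = refl

  status-⟶ : ∀ {c d} → c ⟶ d → status c ≡ false
  status-⟶ (read na)     = na
  status-⟶ (switch na _) = na

  -- By `forced` the tokens must follow the path, and at its end no token is left. `rep-irrefl`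
  -- excludes equality on the way.
  rejecting⇒¬reach : ∀ {c s t q v} → Rep c s t → c ⟶* ⟨ q , [] , v ⟩ →
    accept q ≡ false → turn q ≡ nothing → ¬ Reach s t
  rejecting⇒¬reach r path na stuck equal = rep-irrefl r
  rejecting⇒¬reach r ε na stuck (token x p q rest) with forced x r na p q
  ... | _ , switch _ z , _ = contradiction (trans (sym z) stuck) λ ()
  rejecting⇒¬reach r (st ◅ path) na stuck (token x p q rest) with forced x r (status-⟶ st) p q
  ... | c' , st' , r' with ⟶-deterministic st st' | r'
  ...   | refl | inj₁ r'' = rejecting⇒¬reach r'' path na stuck rest
  ...   | refl | inj₂ r'' = rejecting⇒¬reach r'' path na stuck (reach-sym rest)

  view-read : ∀ f l q a → view (dec (enc (rd f l q a))) ≡ body l (proj₁ (δ q a)) (proj₂ (δ q a))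
  view-read f l q a = afterRead {f = f} (dec-enc (rd f l q a))

  follow : ∀ {c c' s t} → Rep c s t → c ⟶ c' →
    ∃ λ s' → ∃ λ t' → Rep c' s' t' × (Reach s' t' → Reach s t)
  follow (start {l} {q} {b} {i = i} {s} e h) (read na) =
    _ , _ , mid h (view-read true (next l) q b) [] ,
    emit (rd true (next l) q b) i s ⊥ˢ [] e (last-first refl refl refl) refl base-first
  follow (mid {l} {q} {i = i} {t = t} (_∷_ {b = b} {i = j} {s} e h) f g) (read na) =
    _ , _ , mid h (view-read false (next l) q b) (f ∷ g) ,
    emit (rd false (next l) q b) j s i t e (body-read refl refl) f (body-write refl refl)
  follow (mid {l} {q} {i = i} {t = t} [] f g) (switch na z) =
    _ , _ , start (afterEnd {q = q} (dec-enc (end (next l) q)) z) (f ∷ g) ,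
    λ r → emit (end (next l) q) ⊥ˢ [] i t refl base-end f (body-end refl refl z) (reach-sym r)

  data Accepted : Stack → Set where
    []  : Accepted (⊥ˢ ∷ [])
    _∷_ : ∀ {l q b i s} → view (dec i) ≡ body l q b × accept q ≡ true → Accepted s → Accepted (i ∷ s)

  wipe-all : ∀ {s} → Accepted s → Reach s (⊥ˢ ∷ [])
  wipe-all []                            = equal
  wipe-all (_∷_ {i = i} {s} (e , a) h) =
    emit wipe i s ⊥ˢ [] e (body-wipe a) refl base-wipe (wipe-all h)

  -- After acceptance reading tokens still complete the sweep, although the automaton has stopped.
  -- This brings one stack down to its bottom and leaves only wipeable letters on the other.
  finish : ∀ {l q b u i s t} → Holds l u s → accept q ≡ true →
    view (dec i) ≡ body (next l) q b → Accepted t → Reach s (i ∷ t)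
  finish [] a f t = reach-sym (wipe-all ((f , a) ∷ t))
  finish {l} {q} {i = i} {t = t} (_∷_ {b = b} {i = j} {s} e h) a f g =
    emit (rd false (next l) q b) j s i t e (body-read refl refl) f (body-write refl refl)
      (finish h (accept-δ q b a) (view-read false (next l) q b) ((f , a) ∷ g))

  accepting⇒reach : ∀ {c s t q u} → Rep c s t → c ⟶* ⟨ q , u , [] ⟩ → accept q ≡ true → Reach s t
  -- As nothing is written yet, the configuration is represented by `start`, and there is a letter
  -- to begin the last sweep with.
  accepting⇒reach (start {l} {q} {b} {i = i} {s} e h) ε a =
    emit (rd true (next l) q b) i s ⊥ˢ [] e (last-first refl refl refl) refl base-first
      (finish h (accept-δ q b a) (view-read true (next l) q b) [])
  accepting⇒reach r (st ◅ path) a with follow r st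
  ... | _ , _ , r' , back = back (accepting⇒reach r' path a)

  -- The initial stacks

  initial : ℕ → ℕ → List (Fin k)
  initial m n = ⊥ˢ ∷ replicate m (enc (inp false)) ++ replicate n (enc (inp true)) ++ enc ini ∷ []

  initial-word : ℕ → ℕ → List A
  initial-word m n = a₀ ∷ replicate n (input true) ʳ++ replicate m (input false) ʳ++ []

  initial-ʳ++ : ∀ m n → initial m n ʳ++ [] ≡
    enc ini ∷ replicate n (enc (inp true)) ʳ++ replicate m (enc (inp false)) ʳ++ ⊥ˢ ∷ []
  initial-ʳ++ m n = trans (++-ʳ++ (replicate m _)) (++-ʳ++ (replicate n _))

  holds-input : ∀ i n {w s} → Holds (suc (suc zero)) w s →
    Holds (suc (suc zero)) (replicate n (input i) ʳ++ w) (replicate n (enc (inp i)) ʳ++ s)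
  holds-input i zero    h = h
  holds-input i (suc n) h = holds-input i n (cong view (dec-enc (inp i)) ∷ h)

  rep-initial : ∀ m n → Rep ⟨ q₀ , initial-word m n , [] ⟩ (initial m n ʳ++ []) (⊥ˢ ∷ [])
  rep-initial m n rewrite initial-ʳ++ m n = start refl (holds-input true n (holds-input false m []))

  -- Only tokens have table entries, which makes the initial stacks settled.
  inert : ∀ d {x} → (∀ t → dec x ≢ tok t) → act d x ≡ nothing
  inert d {x} ne with act d x in eq
  ... | nothing = refl
  ... | just m  = contradiction (act⇒ok {d} {x} eq) (lemma (view (dec d)) (dec x) ne)
    where
    lemma : ∀ v y {m} → (∀ t → y ≢ tok t) → ¬ Ok v y m
    lemma v (tok t) n o = n t refl
    lemma v bot     n ()
    lemma v (inp _) n ()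
    lemma v ini     n ()

  settled-inert : ∀ {x s} → (∀ t → dec x ≢ tok t) → Settled s → Settled (x ∷ s)
  settled-inert {s = []}    n p = [-]
  settled-inert {s = d ∷ s} n p = inj₂ (inert d n) Linked.∷ p

  settled-input : ∀ i n {s} → Settled s → Settled (replicate n (enc (inp i)) ʳ++ s)
  settled-input i     zero    p = p
  settled-input false (suc n) p = settled-input false n (settled-inert (λ _ ()) p)
  settled-input true  (suc n) p = settled-input true n (settled-inert (λ _ ()) p)

  settled-initial : ∀ m n → Settled (initial m n ʳ++ [])
  settled-initial m n rewrite initial-ʳ++ m n =
    settled-inert (λ _ ()) (settled-input true n (settled-input false m [-]))

  accepting⇒commonTerm : ∀ m n {q u} → ⟨ q₀ , initial-word m n , [] ⟩ ⟶* ⟨ q , u , [] ⟩ →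
    accept q ≡ true → CommonTerm rules (plain (initial m n)) (plain (⊥ˢ ∷ []))
  accepting⇒commonTerm m n path a =
    reach⇒commonTerm (initial m n) (⊥ˢ ∷ []) (accepting⇒reach (rep-initial m n) path a)

  rejecting⇒¬commonTerm : ∀ m n {q v} → ⟨ q₀ , initial-word m n , [] ⟩ ⟶* ⟨ q , [] , v ⟩ →
    accept q ≡ false → turn q ≡ nothing → ¬ CommonTerm rules (plain (initial m n)) (plain (⊥ˢ ∷ []))
  rejecting⇒¬commonTerm m n path na stuck c = rejecting⇒¬reach (rep-initial m n) path na stuck
    (commonTerm⇒reach (initial m n) (⊥ˢ ∷ []) (settled-initial m n) [-] c)

-- Register programs as sweeping automata

Store : Set
Store = ℕ → ℕ

_[_≔_] : Store → ℕ → ℕ → Store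
(ρ [ r ≔ n ]) i with i ≟ r
... | yes _ = n
... | no _  = ρ i

-- nothing stands for the constant 0.
value : Store → Maybe ℕ → ℕ
value ρ (just s) = ρ s
value ρ nothing  = 0

infix 5 _:=_
infixr 4 _⨾_

-- Copying is primitive because one sweep can copy a whole column of bits; `while` merges its test
-- with a decrement because one sweep does both.
data Cmd : Set where
  _:=_  : ℕ → Maybe ℕ → Cmd
  inc   : ℕ → Cmd
  _⨾_   : Cmd → Cmd → Cmd
  while : ℕ → Cmd → Cmd

data Exec : Cmd → Store → Store → Set where
  x-set   : ∀ {r s ρ} → Exec (r := s) ρ (ρ [ r ≔ value ρ s ])
  x-inc   : ∀ {r ρ} → Exec (inc r) ρ (ρ [ r ≔ suc (ρ r) ])
  x-seq   : ∀ {c d ρ₁ ρ₂ ρ₃} → Exec c ρ₁ ρ₂ → Exec d ρ₂ ρ₃ → Exec (c ⨾ d) ρ₁ ρ₃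
  x-stop  : ∀ {r c ρ} → ρ r ≡ 0 → Exec (while r c) ρ ρ
  x-again : ∀ {r c ρ₁ ρ₂ ρ₃ n} → ρ₁ r ≡ suc n → Exec c (ρ₁ [ r ≔ n ]) ρ₂ →
            Exec (while r c) ρ₂ ρ₃ → Exec (while r c) ρ₁ ρ₃

srcBound : Maybe ℕ → ℕ
srcBound (just s) = suc s
srcBound nothing  = 0

bound : Cmd → ℕ
bound (r := s)    = suc r ⊔ srcBound s
bound (inc r)     = suc r
bound (c ⨾ d)     = bound c ⊔ bound d
bound (while r c) = suc r ⊔ bound c

Pos : Cmd → Set
Pos (r := s)    = ⊤
Pos (inc r)     = ⊤
Pos (c ⨾ d)     = Pos c ⊎ Pos d
Pos (while r c) = ⊤ ⊎ Pos c

pos-finite : ∀ c → Finite (Pos c)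
pos-finite (r := s)    = ⊤-finite
pos-finite (inc r)     = ⊤-finite
pos-finite (c ⨾ d)     = pos-finite c ⊎-finite pos-finite d
pos-finite (while r c) = ⊤-finite ⊎-finite pos-finite c

entry : ∀ c → Pos c
entry (r := s)    = tt
entry (inc r)     = tt
entry (c ⨾ d)     = inj₁ (entry c)
entry (while r c) = inj₁ tt

data Instr (N : Set) : Set where
  set        : ℕ → Maybe ℕ → N → Instr N
  inc        : ℕ → N → Instr N
  -- tryDec r n m: decrement r and go to n if r is positive, go to m otherwise
  tryDec     : ℕ → N → N → Instr N
  succeed    : Instr N
  fail       : Instr N

-- `ι` places the positions of a subprogram in the whole program, and `exit` is where control goes
-- afterwards.
code : ∀ {N} c → (Pos c → N) → N → Pos c → Instr N
code (r := s)    ι exit tt        = set r s exit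
code (inc r)     ι exit tt        = inc r exit
code (c ⨾ d)     ι exit (inj₁ p)  = code c (ι ∘ inj₁) (ι (inj₂ (entry d))) p
code (c ⨾ d)     ι exit (inj₂ p)  = code d (ι ∘ inj₂) exit p
code (while r c) ι exit (inj₁ tt) = tryDec r (ι (inj₂ (entry c))) exit
code (while r c) ι exit (inj₂ p)  = code c (ι ∘ inj₂) (ι (inj₁ tt)) p

-- Registers as columns of bits

bit : ∀ {R} → Vec Bool R → ℕ → Bool
bit []      r       = false
bit (b ∷ a) zero    = b
bit (b ∷ a) (suc r) = bit a r

update : ∀ {R} → ℕ → Bool → Vec Bool R → Vec Bool R
update r       b []      = []
update zero    b (c ∷ a) = b ∷ a
update (suc r) b (c ∷ a) = c ∷ update r b a

bit-update : ∀ {R} r b (a : Vec Bool R) → r < R → bit (update r b a) r ≡ b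
bit-update zero    b (c ∷ a) p       = refl
bit-update (suc r) b (c ∷ a) (s≤s p) = bit-update r b a p

bit-update-≢ : ∀ {R} r b (a : Vec Bool R) i → i ≢ r → bit (update r b a) i ≡ bit a i
bit-update-≢ r       b []      i       p = refl
bit-update-≢ zero    b (c ∷ a) zero    p = contradiction refl p
bit-update-≢ zero    b (c ∷ a) (suc i) p = refl
bit-update-≢ (suc r) b (c ∷ a) zero    p = refl
bit-update-≢ (suc r) b (c ∷ a) (suc i) p = bit-update-≢ r b a i (p ∘ cong suc)

blank : ∀ R → Vec Bool R
blank R = Vec.replicate R false

bit-blank : ∀ R i → bit (blank R) i ≡ false
bit-blank zero    i       = refl
bit-blank (suc R) zero    = refl
bit-blank (suc R) (suc i) = bit-blank R i

unit : ∀ R → ℕ → Vec Bool R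
unit R r = update r true (blank R)

source : ∀ {R} → Vec Bool R → Maybe ℕ → Bool
source a (just s) = bit a s
source a nothing  = false

weight : Bool → ℕ
weight true  = 1
weight false = 0

-- A word is a matrix of bits; the content of register r is the number of ones in column r.
count : ∀ {R} → List (Vec Bool R) → ℕ → ℕ
count []      r = 0
count (a ∷ w) r = weight (bit a r) + count w r

count-ʳ++ : ∀ {R} (u v : List (Vec Bool R)) r → count (u ʳ++ v) r ≡ count u r + count v r
count-ʳ++ []      v r = refl
count-ʳ++ (a ∷ u) v r = begin
  count (u ʳ++ (a ∷ v)) r                      ≡⟨ count-ʳ++ u (a ∷ v) r ⟩
  count u r + (weight (bit a r) + count v r)   ≡⟨ ℕ.+-assoc (count u r) _ _ ⟨
  count u r + weight (bit a r) + count v r     ≡⟨ cong (_+ count v r) (ℕ.+-comm (count u r) _) ⟩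
  weight (bit a r) + count u r + count v r     ∎
  where open ≡-Reasoning

count-unit : ∀ {R} r (w : List (Vec Bool R)) → r < R → count (unit R r ∷ w) r ≡ suc (count w r)
count-unit {R} r w p rewrite bit-update r true (blank R) p = refl

count-unit-≢ : ∀ {R} r (w : List (Vec Bool R)) i → i ≢ r → count (unit R r ∷ w) i ≡ count w i
count-unit-≢ {R} r w i p rewrite bit-update-≢ r true (blank R) i p | bit-blank R i = refl

count-units : ∀ {R} r n → r < R → count (replicate n (unit R r)) r ≡ n
count-units r zero    p = refl
count-units {R} r (suc n) p = trans (count-unit r (replicate n (unit R r)) p) (cong suc (count-units r n p))

count-units-≢ : ∀ {R} r n i → i ≢ r → count (replicate n (unit R r)) i ≡ 0
count-units-≢ r zero    i ne = refl
count-units-≢ {R} r (suc n) i ne =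
  trans (count-unit-≢ r (replicate n (unit R r)) i ne) (count-units-≢ {R} r n i ne)

count-blank : ∀ {R} (w : List (Vec Bool R)) i → count (blank R ∷ w) i ≡ count w i
count-blank {R} w i rewrite bit-blank R i = refl

_≈_ : ∀ {R} → List (Vec Bool R) → Store → Set
_≈_ {R} w ρ = ∀ i → i < R → count w i ≡ ρ i

-- The sweeping automaton of a register program

module Machine (R : ℕ) {N : Set} (N-finite : Finite N) (instr : N → Instr N) (n₀ : N) where

  Letter : Set
  Letter = Vec Bool R

  assign : ℕ → Maybe ℕ → Letter → Letter
  assign r s a = update r (source a s) a

  -- The flag records that the bit to be removed by tryDec has been found in this sweep.
  readI : Instr N → Bool → Letter → Bool × Letter
  readI (set r s _)   f     a = f , assign r s a
  readI (tryDec r _ _)   false a = if bit a r then (true , update r false a) else (false , a)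
  readI _             f     a = f , a

  -- Every turn appends a row: a blank one changes no register, and for `inc` the appended row is
  -- itself the increment.
  turnI : Instr N → Bool → Maybe ((N × Bool) × Letter)
  turnI (set r s n) f     = just ((n , false) , blank R)
  turnI (inc r n)   f     = just ((n , false) , unit R r)
  turnI (tryDec r n m) true  = just ((n , false) , blank R)
  turnI (tryDec r n m) false = just ((m , false) , blank R)
  turnI succeed     f     = nothing
  turnI fail        f     = nothing

  acceptI : Instr N → Bool
  acceptI succeed = true
  acceptI _       = false

  sweeper : Sweeper
  sweeper = record
    { Q        = N × Bool
    ; A        = Letter
    ; Q-finite = N-finite ×-finite bool-finite
    ; A-finite = vec-finite bool-finite R
    ; δ        = λ (n , f) a → let (g , b) = readI (instr n) f a in (n , g) , b
    ; turn     = λ (n , f) → turnI (instr n) f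
    ; accept   = λ (n , f) → acceptI (instr n)
    -- Reading keeps the instruction, and acceptance depends on nothing else.
    ; accept-δ = λ _ _ e → e
    ; q₀       = n₀ , false
    ; a₀       = blank R
    ; input    = λ { false → unit R 0 ; true → unit R 1 }
    }

  open SweepSystem sweeper public

  reads : ∀ {n f a w v I} → instr n ≡ I → acceptI I ≡ false →
    ⟨ (n , f) , a ∷ w , v ⟩ ⟶ ⟨ (n , proj₁ (readI I f a)) , w , proj₂ (readI I f a) ∷ v ⟩
  reads refl na = read na

  switches : ∀ {n f v I q b} → instr n ≡ I → acceptI I ≡ false → turnI I f ≡ just (q , b) →
    ⟨ (n , f) , [] , v ⟩ ⟶ ⟨ q , b ∷ v , [] ⟩
  switches refl na e = switch na e

  sweep-set : ∀ {n r s m} → instr n ≡ set r s m → ∀ w v →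
    ⟨ (n , false) , w , v ⟩ ⟶* ⟨ (n , false) , [] , map (assign r s) w ʳ++ v ⟩
  sweep-set e []      v = ε
  sweep-set e (a ∷ w) v = reads e refl ◅ sweep-set e w _

  sweep-inc : ∀ {n r m} → instr n ≡ inc r m → ∀ w v →
    ⟨ (n , false) , w , v ⟩ ⟶* ⟨ (n , false) , [] , w ʳ++ v ⟩
  sweep-inc e []      v = ε
  sweep-inc e (a ∷ w) v = reads e refl ◅ sweep-inc e w _

  sweep-found : ∀ {n r m m'} → instr n ≡ tryDec r m m' → ∀ w v →
    ⟨ (n , true) , w , v ⟩ ⟶* ⟨ (n , true) , [] , w ʳ++ v ⟩
  sweep-found e []      v = ε
  sweep-found e (a ∷ w) v = reads e refl ◅ sweep-found e w _

  sweep-dec : ∀ {n r m m'} → r < R → instr n ≡ tryDec r m m' → ∀ w v →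
    (count w r ≡ 0 × ⟨ (n , false) , w , v ⟩ ⟶* ⟨ (n , false) , [] , w ʳ++ v ⟩) ⊎
    ∃ λ w' → count w r ≡ suc (count w' r) × (∀ i → i ≢ r → count w' i ≡ count w i) ×
             ⟨ (n , false) , w , v ⟩ ⟶* ⟨ (n , true) , [] , w' ʳ++ v ⟩
  sweep-dec p e [] v = inj₁ (refl , ε)
  sweep-dec {n} {r} {m} {m'} p e (a ∷ w) v with bit a r in b | reads {f = false} {a} {w} {v} e refl
  ... | true | st = inj₂ (update r false a ∷ w ,
    cong (λ c → suc (weight c + count w r)) (sym (bit-update r false a p)) ,
    (λ i ne → cong (λ c → weight c + count w i) (bit-update-≢ r false a i ne)) ,
    st ◅ sweep-found e w _)
  ... | false | st with sweep-dec p e w (a ∷ v)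
  ...   | inj₁ (z , path) = inj₁ (z , st ◅ path)
  ...   | inj₂ (w' , c , o , path) = inj₂ (a ∷ w' ,
    trans c (cong (λ c → suc (weight c + count w' r)) (sym b)) ,
    (λ i ne → cong (weight (bit a i) +_) (o i ne)) , st ◅ path)

  count-reversed : ∀ (w : List Letter) i → count (w ʳ++ []) i ≡ count w i
  count-reversed w i = trans (count-ʳ++ w [] i) (ℕ.+-identityʳ _)

  sourceCount : List Letter → Maybe ℕ → ℕ
  sourceCount w (just s) = count w s
  sourceCount w nothing  = 0

  count-assign : ∀ r s w → r < R → count (map (assign r s) w) r ≡ sourceCount w s
  count-assign r (just s) []      p = refl
  count-assign r nothing  []      p = refl
  count-assign r (just s) (a ∷ w) p =
    cong₂ (λ b n → weight b + n) (bit-update r (bit a s) a p) (count-assign r (just s) w p)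
  count-assign r nothing  (a ∷ w) p =
    cong₂ (λ b n → weight b + n) (bit-update r false a p) (count-assign r nothing w p)

  count-assign-≢ : ∀ r s w i → i ≢ r → count (map (assign r s) w) i ≡ count w i
  count-assign-≢ r s []      i ne = refl
  count-assign-≢ r s (a ∷ w) i ne =
    cong₂ (λ b n → weight b + n) (bit-update-≢ r (source a s) a i ne) (count-assign-≢ r s w i ne)

  source≈ : ∀ {w ρ} s → srcBound s ≤ R → w ≈ ρ → sourceCount w s ≡ value ρ s
  source≈ (just s) p h = h s p
  source≈ nothing  p h = refl

  at : N → List Letter → Config
  at n w = ⟨ (n , false) , w , [] ⟩

  infix 4 _leadsTo_

  -- All words for the store are allowed, since many matrices have the same column sums and the
  -- history decides which one occurs.
  _leadsTo_ : N × Store → N × Store → Set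
  (n , ρ) leadsTo (m , σ) = ∀ w → w ≈ ρ → ∃ λ u → at n w ⟶* at m u × u ≈ σ

  leads-trans : ∀ {a b c} → a leadsTo b → b leadsTo c → a leadsTo c
  leads-trans f g w h with f w h
  ... | u , p , h' with g u h'
  ...   | t , q , h'' = t , p ◅◅ q , h''

  do-set : ∀ {n r s m ρ} → suc r ⊔ srcBound s ≤ R → instr n ≡ set r s m →
    (n , ρ) leadsTo (m , ρ [ r ≔ value ρ s ])
  do-set {r = r} {s} {ρ = ρ} p e w h = _ , sweep-set e w [] ◅◅ (switches e refl refl ◅ ε) , counts
    where
    counts : (blank R ∷ map (assign r s) w ʳ++ []) ≈ (ρ [ r ≔ value ρ s ])
    counts i q rewrite count-blank (map (assign r s) w ʳ++ []) i
                     | count-reversed (map (assign r s) w) i with i ≟ r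
    ... | yes refl = trans (count-assign r s w q) (source≈ s (ℕ.m⊔n≤o⇒n≤o _ _ p) h)
    ... | no ne    = trans (count-assign-≢ r s w i ne) (h i q)

  do-inc : ∀ {n r m ρ} → r < R → instr n ≡ inc r m → (n , ρ) leadsTo (m , ρ [ r ≔ suc (ρ r) ])
  do-inc {r = r} {ρ = ρ} p e w h = _ , sweep-inc e w [] ◅◅ (switches e refl refl ◅ ε) , counts
    where
    counts : (unit R r ∷ w ʳ++ []) ≈ (ρ [ r ≔ suc (ρ r) ])
    counts i q with i ≟ r
    ... | yes refl = trans (count-unit r (w ʳ++ []) p) (cong suc (trans (count-reversed w r) (h r p)))
    ... | no ne    = trans (count-unit-≢ r (w ʳ++ []) i ne) (trans (count-reversed w i) (h i q))

  do-dec-zero : ∀ {n r m m' ρ} → r < R → instr n ≡ tryDec r m m' → ρ r ≡ 0 → (n , ρ) leadsTo (m' , ρ)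
  do-dec-zero {r = r} p e z w h with sweep-dec p e w []
  ... | inj₂ (_ , c , _) = contradiction (trans (sym (trans (h r p) z)) c) λ ()
  ... | inj₁ (_ , path)  = _ , path ◅◅ (switches e refl refl ◅ ε) ,
    λ i q → trans (count-blank (w ʳ++ []) i) (trans (count-reversed w i) (h i q))

  do-dec-suc : ∀ {n r m m' k ρ} → r < R → instr n ≡ tryDec r m m' → ρ r ≡ suc k →
    (n , ρ) leadsTo (m , ρ [ r ≔ k ])
  do-dec-suc {r = r} {k = k} {ρ} p e z w h with sweep-dec p e w []
  ... | inj₁ (c , _) = contradiction (trans (sym c) (trans (h r p) z)) λ ()
  ... | inj₂ (w' , c , o , path) = _ , path ◅◅ (switches e refl refl ◅ ε) , counts
    where
    counts : (blank R ∷ w' ʳ++ []) ≈ (ρ [ r ≔ k ])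
    counts i q rewrite count-blank (w' ʳ++ []) i | count-reversed w' i with i ≟ r
    ... | yes refl = ℕ.suc-injective (trans (sym c) (trans (h r p) z))
    ... | no ne    = trans (o i ne) (h i q)

  -- Induction on the execution; arbitrary `ι` and `exit` let the hypothesis apply to subprograms in
  -- place.
  simulate : ∀ {c ρ σ} (ι : Pos c → N) exit → (∀ p → instr (ι p) ≡ code c ι exit p) → bound c ≤ R →
    Exec c ρ σ → (ι (entry c) , ρ) leadsTo (exit , σ)
  simulate ι exit e b x-set = do-set b (e tt)
  simulate ι exit e b x-inc = do-inc b (e tt)
  simulate {c ⨾ d} ι exit e b (x-seq x y) = leads-trans
    (simulate (ι ∘ inj₁) _ (e ∘ inj₁) (ℕ.m⊔n≤o⇒m≤o _ _ b) x)
    (simulate (ι ∘ inj₂) _ (e ∘ inj₂) (ℕ.m⊔n≤o⇒n≤o (bound c) _ b) y)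
  simulate {while r c} ι exit e b (x-stop z) = do-dec-zero (ℕ.m⊔n≤o⇒m≤o (suc r) (bound c) b) (e (inj₁ tt)) z
  simulate {while r c} ι exit e b (x-again z x y) = leads-trans
    (do-dec-suc (ℕ.m⊔n≤o⇒m≤o (suc r) (bound c) b) (e (inj₁ tt)) z) (leads-trans
    (simulate (ι ∘ inj₂) _ (e ∘ inj₂) (ℕ.m⊔n≤o⇒n≤o (suc r) _ b) x)
    (simulate ι exit e b y))

-- Register programs for partial recursive functions

look-≡ : ∀ ρ r n → (ρ [ r ≔ n ]) r ≡ n
look-≡ ρ r n with r ≟ r
... | yes _ = refl
... | no ne = contradiction refl ne

look-≢ : ∀ ρ r n i → i ≢ r → (ρ [ r ≔ n ]) i ≡ ρ i
look-≢ ρ r n i p with i ≟ r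
... | yes e = contradiction e p
... | no _  = refl

range : ℕ → ∀ m → Vec ℕ m
range e zero    = []
range e (suc m) = e ∷ range (suc e) m

range-< : ∀ e m {b} → m + e ≤ b → All (_< b) (range e m)
range-< e zero    p = []
range-< e (suc m) {b} p = ℕ.≤-trans (s≤s (ℕ.m≤n+m e m)) p ∷ range-< (suc e) m (subst (_≤ b) (sym (ℕ.+-suc m e)) p)

-- In compile p as d b the arguments are in the registers as, the result goes to register d, and
-- the registers from b on are free.
mutual
  compile : ∀ {n} → PR n → Vec ℕ n → ℕ → ℕ → Cmd
  compile zer                as       d b = d := nothing
  compile succ               (a ∷ []) d b = (d := just a) ⨾ inc d
  compile (proj i)           as       d b = d := just (lookup as i)
  compile (comp {m = m} f gs) as      d b = compiles gs as b (m + b) ⨾ compile f (range b m) d (m + b)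
  compile (prec g h)         (a ∷ as) d b =
    (b := just a) ⨾ (1 + b := nothing) ⨾ compile g as (2 + b) (3 + b) ⨾ precLoop h as b ⨾ (d := just (2 + b))
  compile (mu f)             as       d b =
    (b := nothing) ⨾ compile f (b ∷ as) (1 + b) (2 + b) ⨾ muLoop f as b ⨾ (d := just b)

  -- Register `b` counts the rounds left, `1 + b` the rounds done, and `2 + b` holds the value so
  -- far.
  precLoop : ∀ {n} → PR (suc (suc n)) → Vec ℕ n → ℕ → Cmd
  precLoop h as b = while b (compile h (1 + b ∷ 2 + b ∷ as) (2 + b) (3 + b) ⨾ inc (1 + b))

  -- The decrement by `while` spoils the value in `1 + b`, but the body recomputes it for the next
  -- candidate in `b`.
  muLoop : ∀ {n} → PR (suc n) → Vec ℕ n → ℕ → Cmd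
  muLoop f as b = while (1 + b) (inc b ⨾ compile f (b ∷ as) (1 + b) (2 + b))

  compiles : ∀ {m n} → Vec (PR n) m → Vec ℕ n → ℕ → ℕ → Cmd
  -- Clearing a free register serves as the empty command.
  compiles []       as e b = b := nothing
  compiles (g ∷ gs) as e b = compile g as e b ⨾ compiles gs as (suc e) b

Below : ∀ {n} → ℕ → Vec ℕ n → Set
Below b = All (_< b)

Agree : ℕ → Store → Store → Set
Agree b σ ρ = ∀ i → i < b → σ i ≡ ρ i

agree-map : ∀ {n b σ ρ} {as : Vec ℕ n} → Below b as → Agree b σ ρ → Vec.map σ as ≡ Vec.map ρ as
agree-map []       h = refl
agree-map (p ∷ ps) h = cong₂ _∷_ (h _ p) (agree-map ps h)

below-mono : ∀ {n b c} {as : Vec ℕ n} → b ≤ c → Below b as → Below c as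
below-mono p = All.map (λ q → ℕ.<-≤-trans q p)

Sets : ℕ → ℕ → ℕ → Store → Store → Set
Sets d y b ρ σ = σ d ≡ y × (∀ i → i < b → i ≢ d → σ i ≡ ρ i)

-- `d` may be among the argument registers; `precLoop` overwrites its accumulator in this way.
Correct : ∀ {n} → PR n → Vec ℕ n → ℕ → Set
Correct p xs y = ∀ as d b ρ → Below b as → d < b → Vec.map ρ as ≡ xs →
  ∃ λ σ → Exec (compile p as d b) ρ σ × Sets d y b ρ σ

Corrects : ∀ {m n} → Vec (PR n) m → Vec ℕ n → Vec ℕ m → Set
Corrects {m} gs xs ys = ∀ as e b ρ → Below e as → m + e ≤ b → Vec.map ρ as ≡ xs →
  ∃ λ σ → Exec (compiles gs as e b) ρ σ × Vec.map σ (range e m) ≡ ys × Agree e σ ρ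

sets-write : ∀ d y b ρ → Sets d y b ρ (ρ [ d ≔ y ])
sets-write d y b ρ = look-≡ ρ d y , λ i _ → look-≢ ρ d y i

agree-write : ∀ ρ b r n → b ≤ r → Agree b (ρ [ r ≔ n ]) ρ
agree-write ρ b r n p i q = look-≢ ρ r n i (ℕ.<⇒≢ (ℕ.<-≤-trans q p))

agree-trans : ∀ {b σ τ ρ} → Agree b σ τ → Agree b τ ρ → Agree b σ ρ
agree-trans f g i p = trans (f i p) (g i p)

sets-agree : ∀ {d y b c ρ σ} → Sets d y c ρ σ → b ≤ d → b ≤ c → Agree b σ ρ
sets-agree (_ , o) p q i r = o i (ℕ.<-≤-trans r q) (ℕ.<⇒≢ (ℕ.<-≤-trans r p))

set-agree : ∀ {d b ρ σ} y → Agree b σ ρ → Sets d y b ρ (σ [ d ≔ y ])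
set-agree {d} {σ = σ} y h = look-≡ σ d y , λ i p ne → trans (look-≢ σ d y i ne) (h i p)

1≢ : ∀ {b} → 1 + b ≢ b
1≢ ()

2≢ : ∀ {b} → 2 + b ≢ b
2≢ ()

module _ {n} (f : PR (suc n)) (xs : Vec ℕ n) (y : ℕ)
         (root  : Correct f (y ∷ xs) 0)
         (below : ∀ i → i < y → ∃ λ m → Correct f (i ∷ xs) (suc m)) where

  private
    Sign : ℕ → ℕ → Set
    Sign zero    t = t ≡ 0
    Sign (suc j) t = ∃ λ m → t ≡ suc m

    at : ∀ i j → j + i ≡ y → ∃ λ t → Sign j t × Correct f (i ∷ xs) t
    at i zero    refl = 0 , refl , root
    at i (suc j) refl with below i (s≤s (ℕ.m≤n+m i j))
    ... | m , c = suc m , (m , refl) , c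

    -- Induction on the distance `j` from the candidate `i` to the root `y`; the value in `1 + b`
    -- vanishes exactly at distance 0.
    search : ∀ as b j i ρ → Below b as → Vec.map ρ as ≡ xs → j + i ≡ y → ρ b ≡ i → Sign j (ρ (1 + b)) →
      ∃ λ σ → Exec (muLoop f as b) ρ σ × σ b ≡ y × Agree b σ ρ
    search as b zero    i ρ p e refl q t       = ρ , x-stop t , q , λ _ _ → refl
    search as b (suc j) i ρ p e c q (m , t)    =
      let ρ₁ = ρ [ 1 + b ≔ m ]
          ρ₂ = ρ₁ [ b ≔ suc (ρ₁ b) ]
          c' = trans (ℕ.+-suc j i) c
          b<2+b = ℕ.m≤n⇒m≤1+n (ℕ.n<1+n b)
          agree₂ = agree-trans (agree-write ρ₁ b b (suc (ρ₁ b)) ℕ.≤-refl) (agree-write ρ b (1 + b) m (ℕ.n≤1+n b))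
          at-b = trans (look-≡ ρ₁ b _) (cong suc (trans (look-≢ ρ (1 + b) m b (1≢ ∘ sym)) q))
          (t' , sign , correct) = at (suc i) j c'
          (ρ₃ , x , s) = correct (b ∷ as) (1 + b) (2 + b) ρ₂ (b<2+b ∷ below-mono (ℕ.m≤n+m b 2) p)
                           (ℕ.n<1+n _) (cong₂ _∷_ at-b (trans (agree-map p agree₂) e))
          agree₃ = agree-trans (sets-agree s (ℕ.n≤1+n b) (ℕ.m≤n+m b 2)) agree₂
          (σ , x' , v , a) = search as b j (suc i) ρ₃ p (trans (agree-map p agree₃) e) c'
                               (trans (proj₂ s b b<2+b (1≢ ∘ sym)) at-b) (subst (Sign j) (sym (proj₁ s)) sign)
      in σ , x-again t (x-seq x-inc x) x' , v , agree-trans a agree₃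

  mu-correct : Correct (mu f) xs y
  mu-correct as d b ρ p q e =
    let ρ₁ = ρ [ b ≔ 0 ]
        b<2+b = ℕ.m≤n⇒m≤1+n (ℕ.n<1+n b)
        agree₁ = agree-write ρ b b 0 ℕ.≤-refl
        (t , sign , correct) = at 0 y (ℕ.+-identityʳ y)
        (ρ₂ , x , s) = correct (b ∷ as) (1 + b) (2 + b) ρ₁ (b<2+b ∷ below-mono (ℕ.m≤n+m b 2) p)
                         (ℕ.n<1+n _) (cong₂ _∷_ (look-≡ ρ b 0) (trans (agree-map p agree₁) e))
        agree₂ = agree-trans (sets-agree s (ℕ.n≤1+n b) (ℕ.m≤n+m b 2)) agree₁
        (σ , x' , v , a) = search as b y 0 ρ₂ p (trans (agree-map p agree₂) e) (ℕ.+-identityʳ y)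
                             (trans (proj₂ s b b<2+b (1≢ ∘ sym)) (look-≡ ρ b 0)) (subst (Sign y) (sym (proj₁ s)) sign)
    in _ , x-seq x-set (x-seq x (x-seq x' x-set)) ,
       subst (λ z → Sets d z b ρ (σ [ d ≔ σ b ])) v (set-agree (σ b) (agree-trans a agree₂))

mutual
  -- Induction on derivations, so the compiled program is shown to halt wherever the function has a
  -- value.
  correct : ∀ {n} {p : PR n} {xs y} → Eval p xs y → Correct p xs y
  correct e-zer  as d b ρ p q e = _ , x-set , sets-write d 0 b ρ
  correct e-succ (a ∷ []) d b ρ p q refl = _ , x-seq x-set x-inc ,
    trans (look-≡ _ d _) (cong suc (look-≡ ρ d (ρ a))) ,
    λ i _ ne → trans (look-≢ _ d _ i ne) (look-≢ ρ d (ρ a) i ne)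
  correct (e-proj {i = i}) as d b ρ p q refl = _ , x-set ,
    subst (λ y → Sets d y b ρ (ρ [ d ≔ ρ (lookup as i) ])) (sym (Vec.lookup-map i ρ as)) (sets-write d _ b ρ)
  correct (e-comp {m = m} gs f) as d b ρ p q e =
    let (σ , x , v , a)  = corrects gs as b (m + b) ρ p ℕ.≤-refl e
        (τ , x' , v' , o) = correct f (range b m) d (m + b) σ (range-< b m ℕ.≤-refl)
                              (ℕ.<-≤-trans q (ℕ.m≤n+m b m)) v
    in τ , x-seq x x' , v' , λ i r ne → trans (o i (ℕ.<-≤-trans r (ℕ.m≤n+m b m)) ne) (a i r)
  correct ev@(e-prec-z _) (c ∷ as) d b ρ (r ∷ p) q e = prec-correct ev c as d b ρ r p e
  correct ev@(e-prec-s _ _) (c ∷ as) d b ρ (r ∷ p) q e = prec-correct ev c as d b ρ r p e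
  correct (e-mu {xs = xs} {y} ev below) =
    mu-correct _ xs y (correct ev) (λ i r → proj₁ (below i r) , correct (proj₂ (below i r)))

  corrects : ∀ {m n} {gs : Vec (PR n) m} {xs ys} → EvalVec gs xs ys → Corrects gs xs ys
  corrects ev-[] as e b ρ p q h = _ , x-set , refl , agree-write ρ e b 0 q
  corrects (ev-∷ {m = m} {ys = ys} g gs) as e b ρ p q h =
    let e≤b = ℕ.≤-trans (ℕ.m≤n+m e (suc m)) q
        e<b = ℕ.≤-trans (s≤s (ℕ.m≤n+m e m)) q
        (σ , x , s) = correct g as e b ρ (below-mono e≤b p) e<b h
        agree = sets-agree s ℕ.≤-refl e≤b
        (τ , x' , v , a) = corrects gs as (suc e) b σ (below-mono (ℕ.n≤1+n e) p)
                             (subst (_≤ b) (sym (ℕ.+-suc m e)) q) (trans (agree-map p agree) h)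
    in τ , x-seq x x' , cong₂ _∷_ (trans (a e (ℕ.n<1+n e)) (proj₁ s)) v ,
       agree-trans (λ i r → a i (ℕ.m≤n⇒m≤1+n r)) agree

  prec-correct : ∀ {n} {g : PR n} {h xs x y} → Eval (prec g h) (x ∷ xs) y → ∀ c as d b ρ →
    c < b → Below b as → Vec.map ρ (c ∷ as) ≡ x ∷ xs →
    ∃ λ σ → Exec (compile (prec g h) (c ∷ as) d b) ρ σ × Sets d y b ρ σ
  prec-correct {x = x} ev c as d b ρ q p refl =
    let ρ₁ = ρ [ b ≔ ρ c ]
        ρ₂ = ρ₁ [ 1 + b ≔ 0 ]
        agree₂ = agree-trans (agree-write ρ₁ b (1 + b) 0 (ℕ.n≤1+n b)) (agree-write ρ b b (ρ c) ℕ.≤-refl)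
        (ρ₃ , x₃ , σ , (s₀ , s₁ , s₂ , a) , continue) = iterate ev 0 as b ρ₂ p (agree-map p agree₂)
          (trans (look-≢ ρ₁ (1 + b) 0 b (1≢ ∘ sym)) (look-≡ ρ b _)) (look-≡ ρ₁ (1 + b) 0)
    -- With no further rounds claimed, the counter ends at 0 and the loop stops there.
    in _ , x-seq x-set (x-seq x-set (x-seq x₃ (x-seq (continue σ (x-stop s₀)) x-set))) ,
       subst (λ z → Sets d z b ρ (σ [ d ≔ σ (2 + b) ])) s₂ (set-agree (σ (2 + b)) (agree-trans a agree₂))

  -- A derivation for prec is built up from the last round but executed from the first, so the
  -- claim allows for n further rounds.
  iterate : ∀ {n} {g : PR n} {h xs x y} → Eval (prec g h) (x ∷ xs) y → ∀ n as b ρ → Below b as →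
    Vec.map ρ as ≡ xs → ρ b ≡ n + x → ρ (1 + b) ≡ 0 →
    ∃ λ ρ' → Exec (compile g as (2 + b) (3 + b)) ρ ρ' ×
    ∃ λ σ → (σ b ≡ n × σ (1 + b) ≡ x × σ (2 + b) ≡ y × Agree b σ ρ) ×
            (∀ τ → Exec (precLoop h as b) σ τ → Exec (precLoop h as b) ρ' τ)
  iterate (e-prec-z g) n as b ρ p e q r =
    let (ρ' , x , s) = correct g as (2 + b) (3 + b) ρ (below-mono (ℕ.m≤n+m b 3) p) (ℕ.n<1+n _) e
    in ρ' , x , ρ' ,
       (trans (proj₂ s b (ℕ.m≤n+m _ 2) (2≢ ∘ sym)) (trans q (ℕ.+-identityʳ n)) ,
        trans (proj₂ s (1 + b) (ℕ.m≤n+m _ 1) (1≢ ∘ sym)) r , proj₁ s ,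
        sets-agree s (ℕ.m≤n+m b 2) (ℕ.m≤n+m b 3)) , λ _ l → l
  iterate (e-prec-s {x = x} {y = y} ev h) n as b ρ p e q r =
    let (ρ' , x₀ , σ , (s₀ , s₁ , s₂ , a) , continue) =
          iterate ev (suc n) as b ρ p e (trans q (ℕ.+-suc n x)) r
        σ₁ = σ [ b ≔ n ]
        agree₁ = agree-trans (agree-write σ b b n ℕ.≤-refl) a
        (σ₂ , x₂ , s) = correct h (1 + b ∷ 2 + b ∷ as) (2 + b) (3 + b) σ₁
          (ℕ.m≤n+m _ 1 ∷ ℕ.≤-refl ∷ below-mono (ℕ.m≤n+m b 3) p) ℕ.≤-refl
          (cong₂ _∷_ (trans (look-≢ σ b n (1 + b) 1≢) s₁)
            (cong₂ _∷_ (trans (look-≢ σ b n (2 + b) 2≢) s₂) (trans (agree-map p agree₁) e)))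
        v  = suc (σ₂ (1 + b))
    in ρ' , x₀ , σ₂ [ 1 + b ≔ v ] ,
       (trans (look-≢ σ₂ (1 + b) v b (1≢ ∘ sym)) (trans (proj₂ s b (ℕ.m≤n+m _ 2) (2≢ ∘ sym)) (look-≡ σ b n)) ,
        trans (look-≡ σ₂ (1 + b) v) (cong suc (trans (proj₂ s (1 + b) (ℕ.m≤n+m _ 1) (1≢ ∘ sym))
          (trans (look-≢ σ b n (1 + b) 1≢) s₁))) ,
        trans (look-≢ σ₂ (1 + b) v (2 + b) 1≢) (proj₁ s) ,
        agree-trans (agree-write σ₂ b (1 + b) v (ℕ.n≤1+n b))
          (agree-trans (sets-agree s (ℕ.m≤n+m b 2) (ℕ.m≤n+m b 3)) agree₁)) ,
       λ τ l → continue τ (x-again s₀ (x-seq x₂ x-inc) l)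

-- The diagonal instance

evals₁ : ∀ {n} {p : PR n} {xs x} → Eval p xs x → EvalVec (p ∷ []) xs (x ∷ [])
evals₁ e = ev-∷ e ev-[]

evals₂ : ∀ {n} {p q : PR n} {xs x y} → Eval p xs x → Eval q xs y → EvalVec (p ∷ q ∷ []) xs (x ∷ y ∷ [])
evals₂ e f = ev-∷ e (evals₁ f)

addPR : PR 2
addPR = prec (proj zero) (comp succ (proj (suc zero) ∷ []))

add-eval : ∀ x y → Eval addPR (x ∷ y ∷ []) (x + y)
add-eval zero    y = e-prec-z e-proj
add-eval (suc x) y = e-prec-s (add-eval x y) (e-comp (evals₁ e-proj) e-succ)

triPR : PR 1
triPR = prec zer (comp succ (comp addPR (proj zero ∷ proj (suc zero) ∷ []) ∷ []))

tri-eval : ∀ x → Eval triPR (x ∷ []) (tri x)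
tri-eval zero    = e-prec-z e-zer
tri-eval (suc x) = e-prec-s (tri-eval x)
  (e-comp (evals₁ (e-comp (evals₂ e-proj e-proj) (add-eval x (tri x)))) e-succ)

consPR : ∀ {n} → PR n → PR n → PR n
consPR p q = comp (comp succ (comp addPR (comp triPR (addPR ∷ []) ∷ proj (suc zero) ∷ []) ∷ [])) (p ∷ q ∷ [])

cons-eval : ∀ {n} {p q : PR n} {xs x y} → Eval p xs x → Eval q xs y → Eval (consPR p q) xs (suc (pair x y))
cons-eval {x = x} {y} e f = e-comp (evals₂ e f) (e-comp (evals₁ (e-comp (evals₂
  (e-comp (evals₁ (add-eval x y)) (tri-eval (x + y))) e-proj) (add-eval (tri (x + y)) y))) e-succ)

constPR : ∀ {n} → ℕ → PR n
constPR zero    = zer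
constPR (suc c) = comp succ (constPR c ∷ [])

const-eval : ∀ {n} c {xs : Vec ℕ n} → Eval (constPR c) xs c
const-eval zero    = e-zer
const-eval (suc c) = e-comp (evals₁ (const-eval c)) e-succ

replicatePR : ∀ {n} → ℕ → PR n → PR n → PR n
replicatePR c p q = comp (prec (proj zero) (consPR (constPR c) (proj (suc zero)))) (p ∷ q ∷ [])

replicate-eval : ∀ {n} c {p q : PR n} {xs m l} → Eval p xs m → Eval q xs (encList l) →
  Eval (replicatePR c p q) xs (encList (replicate m c ++ l))
replicate-eval c {m = m} {l} e f = e-comp (evals₂ e f) (go m)
  where
  go : ∀ m → Eval _ (m ∷ encList l ∷ []) (encList (replicate m c ++ l))
  go zero    = e-prec-z e-proj
  go (suc m) = e-prec-s (go m) (cons-eval (const-eval c) e-proj)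

-- On m and n: the code of the instance made of α = ⊥ Iᵐ Jⁿ E, β = ⊥ and the system with code n,
-- where ⊥, I, J, E are the letters 1, 2, 3, 4 and the alphabet has 1 + m letters.
instancePR : PR 2
instancePR = consPR m (consPR
  (consPR (constPR 1) (replicatePR 2 m (replicatePR 3 n (constPR (encList (4 ∷ []))))))
  (consPR (constPR (encList (1 ∷ []))) (consPR n zer)))
  where
  m = proj zero
  n = proj (suc zero)

-- Stated for arbitrary strings, since the codes of the actual instance must never be unfolded.
record SelfInstance {k} (α β : Str k) (S : SRS k) : Set where
  field
    left  : map toℕ α ≡ 1 ∷ replicate k 2 ++ replicate (encSRS S) 3 ++ 4 ∷ []
    right : map toℕ β ≡ 1 ∷ []

instance-eval : ∀ {k} (α β : Str k) S → SelfInstance α β S →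
  Eval instancePR (k ∷ encSRS S ∷ []) (encInstance k α β S)
instance-eval α β S i rewrite SelfInstance.left i | SelfInstance.right i = cons-eval e-proj (cons-eval
  (cons-eval (const-eval 1) (replicate-eval 2 e-proj (replicate-eval 3 e-proj (const-eval (encList (4 ∷ []))))))
  (cons-eval (const-eval (encList (1 ∷ []))) (cons-eval e-proj e-zer)))

store : ℕ → ℕ → Store
store m n zero          = m
store m n (suc zero)    = n
store m n (suc (suc _)) = 0

module Diagonal (command : Cmd) where

  N : Set
  N = Pos command ⊎ Fin 3

  pattern test = inj₂ zero
  pattern good = inj₂ (suc zero)
  pattern bad  = inj₂ (suc (suc zero))

  instr : N → Instr N
  instr (inj₁ p) = code command inj₁ test p
  -- The answer is inverted: a positive result in register 2 leads to rejection.
  instr test     = tryDec 2 bad good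
  instr good     = succeed
  instr bad      = fail

  R : ℕ
  R = 3 + bound command

  open Machine R (pos-finite command ⊎-finite fin-finite 3) instr (inj₁ (entry command))

  initial≈ : ∀ m n → initial-word m n ≈ store m n
  initial≈ m n i p = begin
    count (initial-word m n) i                      ≡⟨ count-blank (Js ʳ++ Is ʳ++ []) i ⟩
    count (Js ʳ++ Is ʳ++ []) i                      ≡⟨ count-ʳ++ Js _ i ⟩
    count Js i + count (Is ʳ++ []) i                ≡⟨ cong (count Js i +_) (count-reversed Is i) ⟩
    count Js i + count Is i                         ≡⟨ total i ⟩
    store m n i                                     ∎
    where
    open ≡-Reasoning
    Is = replicate m (unit R 0)
    Js = replicate n (unit R 1)
    total : ∀ i → count Js i + count Is i ≡ store m n i
    total zero          = cong₂ _+_ (count-units-≢ {R} 1 n 0 λ ()) (count-units {R} 0 m (s≤s z≤n))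
    total (suc zero)    = trans
      (cong₂ _+_ (count-units {R} 1 n (s≤s (s≤s z≤n))) (count-units-≢ {R} 0 m 1 λ ())) (ℕ.+-identityʳ n)
    total (suc (suc i)) = cong₂ _+_ (count-units-≢ {R} 1 n (2 + i) λ ()) (count-units-≢ {R} 0 m (2 + i) λ ())

  start-at : ∀ m n → Config
  start-at m n = at (inj₁ (entry command)) (initial-word m n)

  2<R : 2 < R
  2<R = s≤s (s≤s (s≤s z≤n))

  halts : ∀ {m n σ} → Exec command (store m n) σ → (inj₁ (entry command) , store m n) leadsTo (test , σ)
  halts = simulate inj₁ test (λ _ → refl) (ℕ.m≤n+m _ 3)

  succeeds : ∀ {m n σ} → Exec command (store m n) σ → σ 2 ≡ 0 → ∃ λ w → start-at m n ⟶* at good w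
  succeeds {m} {n} x v with leads-trans (halts x) (do-dec-zero 2<R refl v) (initial-word m n) (initial≈ m n)
  ... | w , path , _ = w , path

  fails : ∀ {m n σ} → Exec command (store m n) σ → σ 2 ≡ 1 →
    ∃ λ w → start-at m n ⟶* ⟨ (bad , false) , [] , w ⟩
  fails {m} {n} x v with leads-trans (halts x) (do-dec-suc 2<R refl v) (initial-word m n) (initial≈ m n)
  ... | w , path , _ = _ , path ◅◅ idle w []
    where
    -- Rejection shows only at the end of a sweep, where `fail` has no turn.
    idle : ∀ u v → ⟨ (bad , false) , u , v ⟩ ⟶* ⟨ (bad , false) , [] , u ʳ++ v ⟩
    idle []      v = ε
    idle (a ∷ u) v = reads refl refl ◅ idle u _

  initial-letters : ∀ m n → map toℕ (plain (initial m n)) ≡ 1 ∷ replicate m 2 ++ replicate n 3 ++ 4 ∷ []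
  initial-letters m n = cong (1 ∷_) (trans (letters m _) (cong (replicate m 2 ++_) (letters n _)))
    where
    letters : ∀ m {x} l → map toℕ (plain (replicate m x ++ l)) ≡ replicate m (suc (toℕ x)) ++ map toℕ (plain l)
    letters zero    l = refl
    letters (suc m) l = cong (_ ∷_) (letters m l)

  -- The rules depend on the command alone and the inputs enter only through `α`, so `α` may contain
  -- the code of `rules` without any fixed-point theorem.
  α β : Str k
  α = plain (initial k (encSRS rules))
  β = plain (⊥ˢ ∷ [])

  self : SelfInstance α β rules
  self = record { left = initial-letters k (encSRS rules) ; right = refl }

  -- A common term would make `f` answer 1 and the program reject, so there is none; hence `f`
  -- answers 0, the program accepts and there is one. This order avoids a case distinction on
  -- solvability.
  undecided : ∀ f →
    (∀ {k y} (α β : Str k) S → SelfInstance α β S → Eval f (encInstance k α β S ∷ []) y →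
       ∃ λ σ → Exec command (store k (encSRS S)) σ × σ 2 ≡ y) →
    ¬ DecidesCommonTerm f
  undecided f follows decides = noCommonTerm commonTerm
    where
    verdict = decides k α β rules dwindling convergent
    noCommonTerm : ¬ CommonTerm rules α β
    noCommonTerm c =
      let (σ , x , v) = follows α β rules self (proj₁ verdict c)
      in rejecting⇒¬commonTerm k (encSRS rules) (proj₂ (fails x v)) refl refl c
    commonTerm : CommonTerm rules α β
    commonTerm =
      let (σ , x , v) = follows α β rules self (proj₂ verdict noCommonTerm)
      in accepting⇒commonTerm k (encSRS rules) (proj₂ (succeeds x v)) refl

theorem1 : ¬ (Σ (PR 1) λ f → DecidesCommonTerm f)
-- Registers 0 and 1 hold the inputs, 2 receives the answer, and those from 3 on are free.
theorem1 (f , decides) = Diagonal.undecided (compile program (0 ∷ 1 ∷ []) 2 3) f follows decides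
  where
  program : PR 2
  program = comp f (instancePR ∷ [])
  follows : ∀ {k y} (α β : Str k) S → SelfInstance α β S → Eval f (encInstance k α β S ∷ []) y →
    ∃ λ σ → Exec (compile program (0 ∷ 1 ∷ []) 2 3) (store k (encSRS S)) σ × σ 2 ≡ y
  follows {k} α β S i e
    with correct (e-comp (evals₁ (instance-eval α β S i)) e) (0 ∷ 1 ∷ []) 2 3 (store k (encSRS S))
           (s≤s z≤n ∷ s≤s (s≤s z≤n) ∷ []) ℕ.≤-refl refl
  ... | σ , x , v , _ = σ , x , v
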